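{- Let $n\ge0$ and let $\sigma,\tau\in\mathrm{Typ}(n)$ be types of $n$. The coefficient of $E^+_\tau$ in the expansion of $H_\sigma$ in the basis $\{E^+_\rho:\rho\in\mathrm{Typ}(n)\}$ is $$|\mathcal{PT}^{\mathrm{dyad}}_{\mathrm{dis}}(\sigma, \tau)|.$$
   Context: A type of $n$ is a sequence $\tau=(\tau|^1,\tau|^2,\dots)$ of (possibly empty) integer partitions with $\sum_{i\ge1} i\,|\tau|^i|=n$, where $|\tau|^i|$ is the size of the partition $\tau|^i$; $\mathrm{Typ}(n)$ is the set of types of $n$. Each part $d$ of $\tau|^r$ gives a block $d^r$ of $\tau$ (degree $d$, multiplicity $r$; not exponentiation); a type is thus a multiset of blocks. Let $x_{i,j}$ ($i,j\ge 1$) be indeterminates with $\deg x_{i,j}=i$; all series have rational coefficients. A monomial is square-free if every exponent is at most $1$. $H_d$ is the sum of all monomials of degree $d$; $E^+_d$ is the sum of all square-free monomials of degree $d$. For $F\in\{H,E^+\}$, $F_{d^r}$ is obtained from $F_d$ by replacing each $x_{i,j}$ by $x_{i,j}^r$, and $F_\tau=\prod F_{d^r}$ over all blocks $d^r$ of $\tau$ (counted with repetition; empty product $=1$). It is known that $\{F_\tau\}_{\tau\in\mathrm{Typ}(n)}$ is, for each such $F$, a $\mathbb{Q}$-basis of the space $\mathrm{PSym}(n)$ of polysymmetric functions of degree $n$ (power series homogeneous of degree $n$ that are symmetric separately in each variable set $\{x_{i,j}\}_{j\ge1}$). The diagram of a partition $\lambda$ has left-justified rows of $\lambda_1,\lambda_2,\dots$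 cells; the tensor diagram of $\sigma$ is the sequence of diagrams of $\sigma|^1,\sigma|^2,\dots$, the $i$th one being called the $i$th tensor factor. A brick is a nonempty set of consecutive cells in one row; its length is its number of cells. For $k\ge0$, a $k$-brick is a brick whose length is a multiple of $2^k$, carrying the marking $k$. A dyadic polybrick tabloid of shape $\sigma$ and content $\tau$ is a decomposition of the tensor diagram of $\sigma$ into disjoint $k$-bricks (for various $k\ge0$, the markings being part of the data) such that, in each row, whenever $k'>k$ every $k'$-brick appears to the right of every $k$-brick, and such that $\tau$ is the multiset of blocks obtained by taking a block $b^{2^k m}$ for each $k$-brick of length $2^k b$ in the $m$th tensor factor. It is called distinct if in each row of each tensor factor each marking $k$ appears at most once. $\mathcal{PT}^{\mathrm{dyad}}_{\mathrm{dis}}(\sigma,\tau)$ is the set of distinct dyadic polybrick tabloids of shape $\sigma$ and content $\tau$. -}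

module Defs where

open import Data.Bool.Base using (if_then_else_)
open import Data.Integer.Base using (+_)
open import Data.List.Base using (List; []; _∷_; [_]; _++_; map; foldr; upTo; concat; cartesianProductWith)
open import Data.List.Membership.Propositional using (_∉_)
open import Data.List.Relation.Binary.Permutation.Propositional using (_↭_)
open import Data.List.Relation.Unary.All using (All; all?; reduce)
open import Data.List.Relation.Unary.AllPairs using (AllPairs)
open import Data.List.Relation.Unary.Linked using (Linked)
open import Data.List.Relation.Unary.Unique.Propositional using (Unique)
open import Data.Nat.Base as ℕ using (ℕ; zero; suc; NonZero; _≤_; _≥_; _^_; _∸_)
open import Data.Nat.Divisibility using (_∣?_)
open import Data.Nat.ListAction using (sum)
open import Data.Nat.Properties using (_≟_; _≤?_; m*n≢0; m^n≢0)
open import Data.Product.Base using (_×_; _,_)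
open import Data.Rational.Base as ℚ using (ℚ; 0ℚ; 1ℚ)
open import Data.Vec.Base using (Vec; []; _∷_; toList)
open import Relation.Binary.PropositionalEquality using (_≡_; _≗_)
open import Relation.Nullary.Decidable using (Dec; does; _×-dec_)

-- weightedSum i (a₀ ∷ a₁ ∷ …) = i a₀ + (i + 1) a₁ + …
weightedSum : ℕ → List ℕ → ℕ
weightedSum i []       = 0
weightedSum i (a ∷ as) = i ℕ.* a ℕ.+ weightedSum (suc i) as

------------------------------------------------------------------------
-- Types and blocks

-- Throughout, propositional side conditions are irrelevant fields, so that
-- _≡_ compares only the underlying combinatorial data.

record Partition : Set where
  constructor mkPartition
  field
    parts       : List ℕ
    .positive   : All NonZero parts
    .decreasing : Linked _≥_ parts

  size : ℕ
  size = sum parts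

open Partition public

-- The weight condition forces τ|ⁱ to be empty for i > n, so only
-- τ|¹, …, τ|ⁿ are stored.
record Typ (n : ℕ) : Set where
  constructor mkTyp
  field
    factors : Vec Partition n
    .weight : weightedSum 1 (map size (toList factors)) ≡ n

open Typ public

record Block : Set where
  constructor mkBlock
  field
    degree                : ℕ
    multiplicity          : ℕ
    .{{multiplicity≢0}}   : NonZero multiplicity

blocksFrom : ∀ {k} (i : ℕ) .{{_ : NonZero i}} → Vec Partition k → List Block
blocksFrom i []       = []
blocksFrom i (p ∷ ps) = map (λ d → mkBlock d i) (parts p) ++ blocksFrom (suc i) ps

blocks : ∀ {n} → Typ n → List Block
blocks τ = blocksFrom 1 (factors τ)

------------------------------------------------------------------------
-- Power series in the x_{i,j}

-- A monomial is given by its exponents: the j-th entry of the i-th row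
-- (counted from 1) is the exponent of x_{i,j}, and missing entries are 0.
-- Lists differing by trailing zeros denote the same monomial; all series
-- constructed below take equal values on them.
Monomial : Set
Monomial = List (List ℕ)

deg : Monomial → ℕ
deg m = weightedSum 1 (map sum m)

-- A series is given by its coefficients.
Series : Set
Series = Monomial → ℚ

sumℚ : List ℚ → ℚ
sumℚ = foldr ℚ._+_ 0ℚ

-- All ways to write an exponent as an ordered sum of two exponents, and the
-- entrywise extension to lists.
splitℕ : ℕ → List (ℕ × ℕ)
splitℕ e = map (λ a → a , e ∸ a) (upTo (suc e))

splitList : ∀ {A : Set} → (A → List (A × A)) → List A → List (List A × List A)
splitList s []       = [ [] , [] ]
splitList s (x ∷ xs) =
  cartesianProductWith (λ (a , b) (as , bs) → a ∷ as , b ∷ bs) (s x) (splitList s xs)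

-- All pairs (a , b) of monomials with a b = m.
factorisations : Monomial → List (Monomial × Monomial)
factorisations = splitList (splitList splitℕ)

indicator : ∀ {P : Set} → Dec P → ℚ
indicator P? = if does P? then 1ℚ else 0ℚ

𝟙 : Series
𝟙 m = indicator (all? (all? (_≟ 0)) m)

infixl 7 _·_
_·_ : Series → Series → Series
(f · g) m = sumℚ (map (λ (a , b) → f a ℚ.* g b) (factorisations m))

-- The substitution x_{i,j} ↦ x_{i,j}^r: the coefficient of m in the result is
-- that of the r-th root of m, or 0 if m is not an r-th power.
substPower : (r : ℕ) .{{_ : NonZero r}} → Series → Series
substPower r f m =
  if does (all? (all? (r ∣?_)) m) then f (map (map (ℕ._/ r)) m) else 0ℚ

H : ℕ → Series
H d m = indicator (deg m ≟ d)

E⁺ : ℕ → Series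
E⁺ d m = indicator (deg m ≟ d ×-dec all? (all? (_≤? 1)) m)

-- For F = H or E⁺: F_{d^r} and F_τ.
blockSeries : (ℕ → Series) → Block → Series
blockSeries F (mkBlock d r) = substPower r (F d)

typeSeries : (ℕ → Series) → ∀ {n} → Typ n → Series
typeSeries F τ = foldr _·_ 𝟙 (map (blockSeries F) (blocks τ))

------------------------------------------------------------------------
-- Linear expansions

-- f = Σ_ρ (coeff ρ) B_ρ with finitely supported coefficients.
record Expansion {I : Set} (B : I → Series) (f : Series) : Set where
  field
    coeff      : I → ℚ
    support    : List I
    unique     : Unique support
    vanishes   : ∀ ρ → ρ ∉ support → coeff ρ ≡ 0ℚ
    expands    : f ≗ λ m → sumℚ (map (λ ρ → coeff ρ ℚ.* B ρ m) support)

open Expansion public using (coeff)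

-- f has an expansion in the family B, and the coefficient of B_τ in any such
-- expansion is q.
IsCoefficient : {I : Set} → (I → Series) → I → Series → ℚ → Set
IsCoefficient B τ f q = Expansion B f × (∀ (e : Expansion B f) → coeff e τ ≡ q)

------------------------------------------------------------------------
-- Dyadic polybrick tabloids

-- A k-brick of length 2^k b, with marking k.
record Brick : Set where
  constructor mkBrick
  field
    marking : ℕ
    b       : ℕ
    .{{b≢0}} : NonZero b

  brickLength : ℕ
  brickLength = 2 ^ marking ℕ.* b

open Brick public using (marking; brickLength)

-- A decomposition of a row into bricks, listed from left to right: its bricks
-- are intervals of cells, hence determined by their lengths.
record RowTiling (ℓ : ℕ) : Set where
  constructor mkRowTiling
  field
    bricks   : List Brick
    .fills   : sum (map brickLength bricks) ≡ ℓ
    .ordered : AllPairs (λ x y → marking x ≤ marking y) bricks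

open RowTiling public using (bricks)

brickBlock : (m : ℕ) .{{_ : NonZero m}} → Brick → Block
brickBlock m (mkBrick k b) =
  mkBlock b (2 ^ k ℕ.* m) {{m*n≢0 (2 ^ k) m {{m^n≢0 2 k}}}}

-- The rows of the tensor diagram of σ correspond to the blocks of σ: a block
-- d^m is a row of length d in the m-th tensor factor.
Tiling : ∀ {n} → Typ n → Set
Tiling σ = All (λ r → RowTiling (Block.degree r)) (blocks σ)

rowBricks : ∀ {n} {σ : Typ n} → Tiling σ → List (List Brick)
rowBricks = reduce bricks

content : ∀ {n} {σ : Typ n} → Tiling σ → List Block
content T = concat (reduce (λ {r} t → map (rowContent r) (bricks t)) T)
  where
  rowContent : Block → Brick → Block
  rowContent (mkBlock _ m) = brickBlock m

record PTdyad {n} (σ τ : Typ n) : Set where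
  constructor mkTabloid
  field
    tiling       : Tiling σ
    .has-content : content {σ = σ} tiling ↭ blocks τ

Distinct : ∀ {n} {σ τ : Typ n} → PTdyad σ τ → Set
Distinct {σ = σ} T =
  All (λ row → Unique (map marking row)) (rowBricks {σ = σ} (PTdyad.tiling T))

record PTdyad-dis {n} (σ τ : Typ n) : Set where
  constructor mkDistinct
  field
    tabloid   : PTdyad σ τ
    .distinct : Distinct tabloid

fromℕ : ℕ → ℚ
fromℕ N = + N ℚ./ 1

{-# OPTIONS --safe #-}
module Submission where

open import Defs
open import Algebra.Bundles using (CommutativeRing)
import Algebra.Properties.CommutativeSemigroup as CSG
open import Data.Fin.Base using (Fin)
open import Data.Integer.Base as ℤ using (ℤ; 0ℤ; +<+)
import Data.Integer.Properties as ℤ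
import Data.Integer.Solver as ℤSolver
open import Data.List.Base using (List; []; _∷_; [_]; _++_; map; foldr; upTo; concat; concatMap; cartesianProduct; cartesianProductWith; applyUpTo; filter; length; lookup; deduplicate)
open import Data.List.Extrema ℤ.≤-totalOrder using (argmax; f[xs]≤f[argmax]; argmax-all)
open import Data.List.Membership.Propositional using (_∈_; _∉_)
open import Data.List.Membership.Propositional.Properties
open import Data.List.Properties using (map-++; map-∘; map-upTo; map-cong; map-id; ∷-injective; ∷-injectiveʳ; filter-all; filter-none; filter-++; ++-identityʳ)
open import Data.List.Relation.Binary.Permutation.Propositional as ↭ using (_↭_; ↭-refl; ↭-sym; ↭-trans; ↭-reflexive; ↭⇒↭ₛ)
import Data.List.Relation.Binary.Permutation.Propositional.Properties as ↭
open import Data.List.Relation.Binary.Pointwise using (Pointwise-≡⇒≡)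
open import Data.List.Relation.Unary.All as All using (All; []; _∷_; all?; reduce)
import Data.List.Relation.Unary.All.Properties as All
open import Data.List.Relation.Unary.AllPairs as AllPairs using (AllPairs; []; _∷_; allPairs?)
import Data.List.Relation.Unary.AllPairs.Properties as AllPairs
open import Data.List.Relation.Unary.Any using (here; there; index)
import Data.List.Relation.Unary.Any.Properties as Any
open import Data.List.Relation.Unary.Linked using (linked?)
open import Data.List.Relation.Unary.Sorted.TotalOrder.Properties using (↗↭↗⇒≋)
open import Data.List.Relation.Unary.Unique.Propositional using (Unique)
import Data.List.Relation.Unary.Unique.DecPropositional.Properties as DecUnique
import Data.List.Relation.Unary.Unique.Propositional.Properties as Unique
import Data.List.Sort as Sort
open import Data.Nat.Base as ℕ using (ℕ; zero; suc; NonZero; _≤_; _<_; z≤n; s≤s; _+_; _*_; _∸_; _^_)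
import Data.Nat.Coprimality as Coprimality
open import Data.Nat.Divisibility using (_∣_; _∣?_; divides; m∣m*n; n∣m*n; ∣-trans; ∣m∣n⇒∣m+n; ∣-refl; _∣0)
import Data.Nat.DivMod as ℕ
open import Data.Nat.ListAction using (sum)
open import Data.Nat.ListAction.Properties using (sum-++; sum-↭)
open import Data.Nat.Properties as ℕ using (_≟_; _≤?_; _≥?_; nonZero?)
open import Data.Nat.Solver using (module +-*-Solver)
open import Data.Product.Base using (_×_; _,_; proj₁; proj₂; ∃-syntax)
open import Data.Rational.Base as ℚ using (ℚ; 0ℚ; 1ℚ)
open import Data.Rational.Properties as ℚ using (+-*-commutativeRing)
open import Data.Sum.Base using (_⊎_; inj₁; inj₂)
open import Data.Vec.Base using (Vec; []; _∷_; toList)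
open import Function.Base using (_∘_; id)
open import Function.Bundles using (_↔_; mk↔ₛ′)
open import Relation.Binary.Bundles using (DecTotalOrder)
import Relation.Binary.Construct.Flip.EqAndOrd as Flip
open import Relation.Binary.Definitions using (DecidableEquality)
open import Relation.Binary.PropositionalEquality hiding ([_])
open import Relation.Nullary using (contradiction; ¬_)
open import Relation.Nullary.Decidable using (Dec; yes; no; ¬?; recompute; map′; _×-dec_; _⊎-dec_; decidable-stable)
open ≡-Reasoning

-- Since 1/(1 - x) = ∏ₖ (1 + x^(2^k)), each H_{d^m} is the sum of the products
-- of the E⁺_{b^{2^k m}} over the distinct tilings of a row of length d by
-- k-bricks of length 2^k b.  Multiplying over the rows of σ expands H_σ with the
-- claimed coefficients.  They are unique because the E⁺_τ are triangular with
-- respect to the monomials ∏ x_{d,j}^r (one variable for each block d^r): if that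
-- monomial of σ occurs in E⁺_τ, then σ arises from τ by splitting degrees and
-- adding up multiplicities, and both operations lower ∑ d r (d - r).

-- The coefficient of a product is a sum over the factorisations of a monomial, so each ring law is
-- checked for a single exponent and then lifted twice, to rows of exponents and to monomials. The
-- identity behind the dyadic product is lifted in the same way: it holds exponent by exponent with
-- degrees ignored, and the degree is put back afterwards because it is additive over
-- factorisations.
--
-- In a row with weakly increasing, distinct markings the bricks amount to one number `b` for each
-- marking `k`, with 0 for no brick. This is exactly a choice of one term from each factor of the
-- product.
--
-- For independence the number of blocks cannot serve as a rank: splitting degrees raises it, while
-- adding multiplicities lowers it. Hence a quadratic potential that moves the same way under both
-- operations. The diagonal coefficients are nonzero because all coefficients of the `E⁺` products
-- are nonnegative, so nothing can cancel. The set of all types is never enumerated: linear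
-- combinations are finite lists in which a type may be repeated.

private variable
  A B C I : Set

-- Sums and convolution

∑ : List A → (A → ℚ) → ℚ
∑ xs f = sumℚ (map f xs)

+-interchange : ∀ a b c d → (a ℚ.+ b) ℚ.+ (c ℚ.+ d) ≡ (a ℚ.+ c) ℚ.+ (b ℚ.+ d)
+-interchange = CSG.interchange (CommutativeRing.+-commutativeSemigroup +-*-commutativeRing)

*-interchange : ∀ a b c d → (a ℚ.* b) ℚ.* (c ℚ.* d) ≡ (a ℚ.* c) ℚ.* (b ℚ.* d)
*-interchange = CSG.interchange (CommutativeRing.*-commutativeSemigroup +-*-commutativeRing)

∑-cong : (xs : List A) {f g : A → ℚ} → (∀ x → f x ≡ g x) → ∑ xs f ≡ ∑ xs g
∑-cong xs f≗g = cong sumℚ (map-cong f≗g xs)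

∑-cong-∈ : (xs : List A) {f g : A → ℚ} → (∀ x → x ∈ xs → f x ≡ g x) → ∑ xs f ≡ ∑ xs g
∑-cong-∈ []       h = refl
∑-cong-∈ (x ∷ xs) h = cong₂ ℚ._+_ (h x (here refl)) (∑-cong-∈ xs λ y → h y ∘ there)

∑-++ : (xs ys : List A) (f : A → ℚ) → ∑ (xs ++ ys) f ≡ ∑ xs f ℚ.+ ∑ ys f
∑-++ []       ys f = sym (ℚ.+-identityˡ _)
∑-++ (x ∷ xs) ys f = trans (cong (f x ℚ.+_) (∑-++ xs ys f)) (sym (ℚ.+-assoc (f x) _ _))

∑-map : (g : A → B) (xs : List A) (f : B → ℚ) → ∑ (map g xs) f ≡ ∑ xs (f ∘ g)
∑-map g xs f = cong sumℚ (sym (map-∘ xs))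

∑-concatMap : (g : A → List B) (xs : List A) (f : B → ℚ) → ∑ (concatMap g xs) f ≡ ∑ xs λ x → ∑ (g x) f
∑-concatMap g []       f = refl
∑-concatMap g (x ∷ xs) f = trans (∑-++ (g x) _ f) (cong (∑ (g x) f ℚ.+_) (∑-concatMap g xs f))

∑-× : (g : A → B → C) (xs : List A) (ys : List B) (f : C → ℚ) →
  ∑ (cartesianProductWith g xs ys) f ≡ ∑ xs λ x → ∑ ys λ y → f (g x y)
∑-× g []       ys f = refl
∑-× g (x ∷ xs) ys f =
  trans (∑-++ (map (g x) ys) _ f) (cong₂ ℚ._+_ (∑-map (g x) ys f) (∑-× g xs ys f))

∑-zero : (xs : List A) {f : A → ℚ} → (∀ x → x ∈ xs → f x ≡ 0ℚ) → ∑ xs f ≡ 0ℚ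
∑-zero []       h = refl
∑-zero (x ∷ xs) h =
  trans (cong₂ ℚ._+_ (h x (here refl)) (∑-zero xs λ y → h y ∘ there)) (ℚ.+-identityˡ 0ℚ)

∑-+ : (xs : List A) (f g : A → ℚ) → ∑ xs (λ x → f x ℚ.+ g x) ≡ ∑ xs f ℚ.+ ∑ xs g
∑-+ []       f g = refl
∑-+ (x ∷ xs) f g = trans (cong (f x ℚ.+ g x ℚ.+_) (∑-+ xs f g)) (+-interchange (f x) (g x) _ _)

∑-swap : (xs : List A) (ys : List B) (f : A → B → ℚ) →
  (∑ xs λ x → ∑ ys λ y → f x y) ≡ ∑ ys λ y → ∑ xs λ x → f x y
∑-swap []       ys f = sym (∑-zero ys λ _ _ → refl)
∑-swap (x ∷ xs) ys f =
  trans (cong (∑ ys (f x) ℚ.+_) (∑-swap xs ys f)) (sym (∑-+ ys (f x) _))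

∑-*ˡ : (c : ℚ) (xs : List A) (f : A → ℚ) → ∑ xs (λ x → c ℚ.* f x) ≡ c ℚ.* ∑ xs f
∑-*ˡ c []       f = sym (ℚ.*-zeroʳ c)
∑-*ˡ c (x ∷ xs) f = trans (cong (c ℚ.* f x ℚ.+_) (∑-*ˡ c xs f)) (sym (ℚ.*-distribˡ-+ c (f x) _))

∑-*ʳ : (c : ℚ) (xs : List A) (f : A → ℚ) → ∑ xs (λ x → f x ℚ.* c) ≡ ∑ xs f ℚ.* c
∑-*ʳ c []       f = sym (ℚ.*-zeroˡ c)
∑-*ʳ c (x ∷ xs) f = trans (cong (f x ℚ.* c ℚ.+_) (∑-*ʳ c xs f)) (sym (ℚ.*-distribʳ-+ c (f x) _))

∑-single : {xs : List A} {x : A} (f : A → ℚ) → Unique xs → x ∈ xs →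
  (∀ y → y ∈ xs → x ≢ y → f y ≡ 0ℚ) → ∑ xs f ≡ f x
∑-single f (x∉ ∷ xs!) (here refl) h =
  trans (cong (f _ ℚ.+_) (∑-zero _ λ y y∈ → h y (there y∈) (All.lookup x∉ y∈))) (ℚ.+-identityʳ _)
∑-single f (x∉ ∷ xs!) (there x∈) h =
  trans (cong₂ ℚ._+_ (h _ (here refl) (λ x≡z → All.lookup x∉ x∈ (sym x≡z)))
                   (∑-single f xs! x∈ λ y → h y ∘ there))
        (ℚ.+-identityˡ _)

-- Coalgebra laws for splittings, and their lift to lists

-- A splitting `s` acts as a comultiplication, with a list in place of a formal sum. The laws below
-- are tested against arbitrary rational functions `F`, so that the order of the list does not
-- matter.
conv : (A → List (A × A)) → A → (A → A → ℚ) → ℚ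
conv s x F = ∑ (s x) λ (a , b) → F a b

conv-cong : (s : A → List (A × A)) (x : A) {F G : A → A → ℚ} →
  (∀ a b → F a b ≡ G a b) → conv s x F ≡ conv s x G
conv-cong s x h = ∑-cong (s x) λ _ → h _ _

Coassociative Cocommutative : (A → List (A × A)) → Set
Coassociative {A} s = ∀ x (F : A → A → A → ℚ) →
  (conv s x λ a b → conv s a λ c d → F c d b) ≡ (conv s x λ a b → conv s b λ c d → F a c d)
Cocommutative {A} s = ∀ x (F : A → A → ℚ) → conv s x F ≡ conv s x λ a b → F b a

Counit : (A → List (A × A)) → (A → ℚ) → Set
Counit {A} s ε = ∀ x (F : A → ℚ) → conv s x (λ a b → ε a ℚ.* F b) ≡ F x

module _ (s : A → List (A × A)) where

  conv-∷ : ∀ x xs (F : List A → List A → ℚ) → conv (splitList s) (x ∷ xs) F ≡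
    conv s x λ a b → conv (splitList s) xs λ as bs → F (a ∷ as) (b ∷ bs)
  conv-∷ x xs F = ∑-× _ (s x) (splitList s xs) _

  -- Head and tail split independently: `∑-swap` brings the two splittings of the head together, the
  -- law for `s` rebrackets them, and induction does the same for the tail.
  splitList-coassoc : Coassociative s → Coassociative (splitList s)
  splitList-coassoc s-coassoc []       F = refl
  splitList-coassoc s-coassoc (x ∷ xs) F = begin
    conv S (x ∷ xs) (λ as bs → conv S as λ cs ds → F cs ds bs)
      ≡⟨ conv-∷ x xs _ ⟩
    (conv s x λ a b → conv S xs λ as bs → conv S (a ∷ as) λ cs ds → F cs ds (b ∷ bs))
      ≡⟨ (conv-cong s x λ a b → trans (conv-cong S xs λ as bs → conv-∷ a as _) (∑-swap (S xs) (s a) _)) ⟩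
    (conv s x λ a b → conv s a λ c d → conv S xs λ as bs → conv S as λ cs ds → F (c ∷ cs) (d ∷ ds) (b ∷ bs))
      ≡⟨ s-coassoc x _ ⟩
    (conv s x λ a b → conv s b λ c d → conv S xs λ as bs → conv S as λ cs ds → F (a ∷ cs) (c ∷ ds) (d ∷ bs))
      ≡⟨ (conv-cong s x λ a b → conv-cong s b λ c d → splitList-coassoc s-coassoc xs _) ⟩
    (conv s x λ a b → conv s b λ c d → conv S xs λ as bs → conv S bs λ cs ds → F (a ∷ as) (c ∷ cs) (d ∷ ds))
      ≡⟨ (conv-cong s x λ a b → trans (conv-cong S xs λ as bs → conv-∷ b bs _) (∑-swap (S xs) (s b) _)) ⟨
    (conv s x λ a b → conv S xs λ as bs → conv S (b ∷ bs) λ cs ds → F (a ∷ as) cs ds)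
      ≡⟨ conv-∷ x xs _ ⟨
    conv S (x ∷ xs) (λ as bs → conv S bs λ cs ds → F as cs ds) ∎
    where S = splitList s

  splitList-cocomm : Cocommutative s → Cocommutative (splitList s)
  splitList-cocomm s-cocomm []       F = refl
  splitList-cocomm s-cocomm (x ∷ xs) F = begin
    conv (splitList s) (x ∷ xs) F ≡⟨ conv-∷ x xs F ⟩
    (conv s x λ a b → conv (splitList s) xs λ as bs → F (a ∷ as) (b ∷ bs))
      ≡⟨ (conv-cong s x λ a b → splitList-cocomm s-cocomm xs _) ⟩
    (conv s x λ a b → conv (splitList s) xs λ as bs → F (a ∷ bs) (b ∷ as))
      ≡⟨ s-cocomm x _ ⟩
    (conv s x λ a b → conv (splitList s) xs λ as bs → F (b ∷ bs) (a ∷ as))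
      ≡⟨ conv-∷ x xs _ ⟨
    conv (splitList s) (x ∷ xs) (λ as bs → F bs as) ∎

prod : (A → ℚ) → List A → ℚ
prod f []       = 1ℚ
prod f (x ∷ xs) = f x ℚ.* prod f xs

conv-*ˡ : ∀ (s : A → List (A × A)) x c F → conv s x (λ a b → c ℚ.* F a b) ≡ c ℚ.* conv s x F
conv-*ˡ s x c F = ∑-*ˡ c (s x) _

splitList-counit : (s : A → List (A × A)) (ε : A → ℚ) → Counit s ε → Counit (splitList s) (prod ε)
splitList-counit s ε s-counit []       F = trans (ℚ.+-identityʳ _) (ℚ.*-identityˡ _)
splitList-counit s ε s-counit (x ∷ xs) F = begin
  conv (splitList s) (x ∷ xs) (λ as bs → prod ε as ℚ.* F bs) ≡⟨ conv-∷ s x xs _ ⟩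
  (conv s x λ a b → conv (splitList s) xs λ as bs → ε a ℚ.* prod ε as ℚ.* F (b ∷ bs))
    ≡⟨ (conv-cong s x λ a b → trans (conv-cong (splitList s) xs λ as bs → ℚ.*-assoc (ε a) _ _) (conv-*ˡ (splitList s) xs (ε a) _)) ⟩
  (conv s x λ a b → ε a ℚ.* conv (splitList s) xs λ as bs → prod ε as ℚ.* F (b ∷ bs))
    ≡⟨ (conv-cong s x λ a b → cong (ε a ℚ.*_) (splitList-counit s ε s-counit xs _)) ⟩
  (conv s x λ a b → ε a ℚ.* F (b ∷ xs)) ≡⟨ s-counit x _ ⟩
  F (x ∷ xs) ∎

-- Convolution preserves multiplicative functions. A condition imposed on every exponent has a
-- multiplicative indicator, so an identity between such conditions reduces to one exponent.
conv-prod : (s : A → List (A × A)) (f g : A → ℚ) (xs : List A) →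
  conv (splitList s) xs (λ as bs → prod f as ℚ.* prod g bs) ≡ prod (λ x → conv s x λ a b → f a ℚ.* g b) xs
conv-prod s f g []       = trans (ℚ.+-identityʳ _) (ℚ.*-identityˡ _)
conv-prod s f g (x ∷ xs) = begin
  conv (splitList s) (x ∷ xs) (λ as bs → prod f as ℚ.* prod g bs) ≡⟨ conv-∷ s x xs _ ⟩
  (conv s x λ a b → conv (splitList s) xs λ as bs → (f a ℚ.* prod f as) ℚ.* (g b ℚ.* prod g bs))
    ≡⟨ (conv-cong s x λ a b → trans (conv-cong (splitList s) xs λ as bs → *-interchange (f a) _ (g b) _)
         (trans (conv-*ˡ (splitList s) xs (f a ℚ.* g b) _) (cong (f a ℚ.* g b ℚ.*_) (conv-prod s f g xs)))) ⟩
  (conv s x λ a b → f a ℚ.* g b ℚ.* prod (λ x → conv s x λ a b → f a ℚ.* g b) xs)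
    ≡⟨ ∑-*ʳ _ (s x) _ ⟩
  prod (λ x → conv s x λ a b → f a ℚ.* g b) (x ∷ xs) ∎

-- Splitting a single exponent

-- Turns `upTo` into a recursion on the exponent: the left part is 0, or one unit can be taken off
-- it.
splitℕ-suc : ∀ e → splitℕ (suc e) ≡ (0 , suc e) ∷ map (λ (a , b) → suc a , b) (splitℕ e)
splitℕ-suc e = cong ((0 , suc e) ∷_) (begin
  map (λ a → a , suc e ∸ a) (applyUpTo suc (suc e)) ≡⟨ cong (map _) (map-upTo suc (suc e)) ⟨
  map (λ a → a , suc e ∸ a) (map suc (upTo (suc e))) ≡⟨ map-∘ (upTo (suc e)) ⟨
  map (λ a → suc a , e ∸ a) (upTo (suc e)) ≡⟨ map-∘ (upTo (suc e)) ⟩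
  map (λ (a , b) → suc a , b) (splitℕ e) ∎)

splitℕ-sound : ∀ e {a b} → (a , b) ∈ splitℕ e → a + b ≡ e
splitℕ-sound e p∈ with ∈-map⁻ _ p∈
... | _ , a∈ , refl = ℕ.m+[n∸m]≡n (ℕ.s≤s⁻¹ (∈-upTo⁻ a∈))

splitℕ-complete : ∀ a b → (a , b) ∈ splitℕ (a + b)
splitℕ-complete zero    zero    = here refl
splitℕ-complete zero    (suc b) = here refl
splitℕ-complete (suc a) b       =
  subst ((suc a , b) ∈_) (sym (splitℕ-suc (a + b))) (there (∈-map⁺ _ (splitℕ-complete a b)))

splitℕ-unique : ∀ e → Unique (splitℕ e)
splitℕ-unique e = Unique.map⁺ (cong proj₁) (Unique.upTo⁺ (suc e))
  where import Data.List.Relation.Unary.Unique.Propositional.Properties as Unique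

indicator-true : {P : Set} (P? : Dec P) → P → indicator P? ≡ 1ℚ
indicator-true (yes _) _ = refl
indicator-true (no ¬p) p = contradiction p ¬p

indicator-false : {P : Set} (P? : Dec P) → (P → 0ℚ ≡ 1ℚ) → indicator P? ≡ 0ℚ
indicator-false (yes p) ¬p = sym (¬p p)
indicator-false (no _)  _  = refl

indicator-cong : {P Q : Set} (P? : Dec P) (Q? : Dec Q) → (P → Q) → (Q → P) → indicator P? ≡ indicator Q?
indicator-cong (yes p) Q? f g = sym (indicator-true Q? (f p))
indicator-cong (no ¬p) Q? f g = sym (indicator-false Q? λ q → contradiction (g q) ¬p)

indicator-× : {P Q : Set} (P? : Dec P) (Q? : Dec Q) → indicator (P? ×-dec Q?) ≡ indicator P? ℚ.* indicator Q?
indicator-× (yes _) Q? = sym (ℚ.*-identityˡ _)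
indicator-× (no _)  Q? = sym (ℚ.*-zeroˡ (indicator Q?))

indicator-all : {P : A → Set} (P? : ∀ x → Dec (P x)) (xs : List A) →
  indicator (all? P? xs) ≡ prod (λ x → indicator (P? x)) xs
indicator-all P? []       = refl
indicator-all P? (x ∷ xs) = trans (indicator-× (P? x) (all? P? xs)) (cong (indicator (P? x) ℚ.*_) (indicator-all P? xs))

prod-cong : (xs : List A) {f g : A → ℚ} → (∀ x → f x ≡ g x) → prod f xs ≡ prod g xs
prod-cong []       h = refl
prod-cong (x ∷ xs) h = cong₂ ℚ._*_ (h x) (prod-cong xs h)

indicator-all² : {P : A → Set} (P? : ∀ x → Dec (P x)) (xss : List (List A)) →
  indicator (all? (all? P?) xss) ≡ prod (prod (λ x → indicator (P? x))) xss
indicator-all² P? xss = trans (indicator-all (all? P?) xss) (prod-cong xss (indicator-all P?))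

-- The coalgebra laws depend on `splitℕ` only through these two equations; with `s` abstract,
-- nothing unfolds further.
module _ (s : ℕ → List (ℕ × ℕ)) (s-zero : s 0 ≡ [ 0 , 0 ])
         (s-suc : ∀ e → s (suc e) ≡ (0 , suc e) ∷ map (λ (a , b) → suc a , b) (s e)) where

  conv-zero : ∀ F → conv s 0 F ≡ F 0 0
  conv-zero F = trans (cong (λ l → ∑ l λ (a , b) → F a b) s-zero) (ℚ.+-identityʳ _)

  conv-sucˡ : ∀ e F → conv s (suc e) F ≡ F 0 (suc e) ℚ.+ conv s e λ a b → F (suc a) b
  conv-sucˡ e F = trans (cong (λ l → ∑ l λ (a , b) → F a b) (s-suc e)) (cong (F 0 (suc e) ℚ.+_) (∑-map _ (s e) _))

  -- Cocommutativity exchanges the two ends of the list of splittings, so peeling off the left end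
  -- needs this counterpart on the right.
  conv-sucʳ : ∀ e F → conv s (suc e) F ≡ (conv s e λ a b → F a (suc b)) ℚ.+ F (suc e) 0
  conv-sucʳ zero    F = begin
    conv s 1 F                               ≡⟨ conv-sucˡ 0 F ⟩
    F 0 1 ℚ.+ (conv s 0 λ a b → F (suc a) b)   ≡⟨ cong₂ ℚ._+_ (sym (conv-zero _)) (conv-zero _) ⟩
    (conv s 0 λ a b → F a (suc b)) ℚ.+ F 1 0   ∎
  conv-sucʳ (suc e) F = begin
    conv s (2 + e) F ≡⟨ conv-sucˡ (suc e) F ⟩
    F 0 (2 + e) ℚ.+ conv s (suc e) (λ a b → F (suc a) b)
      ≡⟨ cong (F 0 (2 + e) ℚ.+_) (conv-sucʳ e _) ⟩
    F 0 (2 + e) ℚ.+ ((conv s e λ a b → F (suc a) (suc b)) ℚ.+ F (2 + e) 0)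
      ≡⟨ ℚ.+-assoc (F 0 (2 + e)) _ _ ⟨
    F 0 (2 + e) ℚ.+ (conv s e λ a b → F (suc a) (suc b)) ℚ.+ F (2 + e) 0
      ≡⟨ cong (ℚ._+ F (2 + e) 0) (conv-sucˡ e _) ⟨
    (conv s (suc e) λ a b → F a (suc b)) ℚ.+ F (2 + e) 0 ∎

  s-cocomm : Cocommutative s
  s-cocomm zero    F = trans (conv-zero F) (sym (conv-zero _))
  s-cocomm (suc e) F = begin
    conv s (suc e) F ≡⟨ conv-sucˡ e F ⟩
    F 0 (suc e) ℚ.+ (conv s e λ a b → F (suc a) b) ≡⟨ ℚ.+-comm (F 0 (suc e)) _ ⟩
    (conv s e λ a b → F (suc a) b) ℚ.+ F 0 (suc e) ≡⟨ cong (ℚ._+ F 0 (suc e)) (s-cocomm e _) ⟩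
    (conv s e λ a b → F (suc b) a) ℚ.+ F 0 (suc e) ≡⟨ conv-sucʳ e _ ⟨
    conv s (suc e) (λ a b → F b a) ∎

  s-coassoc : Coassociative s
  s-coassoc zero    F = begin
    conv s 0 (λ a b → conv s a λ c d → F c d b) ≡⟨ trans (conv-zero _) (conv-zero _) ⟩
    F 0 0 0 ≡⟨ trans (conv-zero _) (conv-zero _) ⟨
    conv s 0 (λ a b → conv s b λ c d → F a c d) ∎
  s-coassoc (suc e) F = begin
    conv s (suc e) (λ a b → conv s a λ c d → F c d b) ≡⟨ conv-sucˡ e _ ⟩
    conv s 0 (λ c d → F c d (suc e)) ℚ.+ (conv s e λ a b → conv s (suc a) λ c d → F c d b)
      ≡⟨ cong₂ ℚ._+_ (conv-zero _) (conv-cong s e λ a b → conv-sucˡ a _) ⟩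
    F 0 0 (suc e) ℚ.+ (conv s e λ a b → F 0 (suc a) b ℚ.+ conv s a λ c d → F (suc c) d b)
      ≡⟨ cong (F 0 0 (suc e) ℚ.+_) (∑-+ (s e) _ _) ⟩
    F 0 0 (suc e) ℚ.+ ((conv s e λ a b → F 0 (suc a) b) ℚ.+ conv s e λ a b → conv s a λ c d → F (suc c) d b)
      ≡⟨ ℚ.+-assoc (F 0 0 (suc e)) _ _ ⟨
    F 0 0 (suc e) ℚ.+ (conv s e λ a b → F 0 (suc a) b) ℚ.+ (conv s e λ a b → conv s a λ c d → F (suc c) d b)
      ≡⟨ cong₂ ℚ._+_ (sym (conv-sucˡ e _)) (s-coassoc e _) ⟩
    conv s (suc e) (F 0) ℚ.+ (conv s e λ a b → conv s b λ c d → F (suc a) c d)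
      ≡⟨ conv-sucˡ e _ ⟨
    conv s (suc e) (λ a b → conv s b λ c d → F a c d) ∎

  s-counit : Counit s (λ e → indicator (e ≟ 0))
  s-counit zero    F = trans (conv-zero _) (ℚ.*-identityˡ _)
  s-counit (suc e) F = trans (conv-sucˡ e _)
    (trans (cong₂ ℚ._+_ (ℚ.*-identityˡ (F (suc e))) (∑-zero (s e) λ (_ , b) _ → ℚ.*-zeroˡ (F b))) (ℚ.+-identityʳ _))

splitℕ-cocomm : Cocommutative splitℕ
splitℕ-cocomm = s-cocomm splitℕ refl splitℕ-suc

splitℕ-coassoc : Coassociative splitℕ
splitℕ-coassoc = s-coassoc splitℕ refl splitℕ-suc

splitℕ-counit : Counit splitℕ (λ e → indicator (e ≟ 0))
splitℕ-counit = s-counit splitℕ refl splitℕ-suc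

-- The algebra of series and products of blocks

·-cong : ∀ {f f′ g g′} → f ≗ f′ → g ≗ g′ → f · g ≗ f′ · g′
·-cong f≗ g≗ m = ∑-cong (factorisations m) λ (a , b) → cong₂ ℚ._*_ (f≗ a) (g≗ b)

·-assoc : ∀ f g h → (f · g) · h ≗ f · (g · h)
·-assoc f g h m = begin
  ((f · g) · h) m
    ≡⟨ ∑-cong (factorisations m) (λ (a , b) → sym (∑-*ʳ (h b) (factorisations a) _)) ⟩
  (conv factorisations m λ a b → conv factorisations a λ c d → f c ℚ.* g d ℚ.* h b)
    ≡⟨ splitList-coassoc _ (splitList-coassoc _ splitℕ-coassoc) m _ ⟩
  (conv factorisations m λ a b → conv factorisations b λ c d → f a ℚ.* g c ℚ.* h d)
    ≡⟨ ∑-cong (factorisations m) (λ (a , b) →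
         trans (∑-cong (factorisations b) λ _ → ℚ.*-assoc (f a) _ _) (∑-*ˡ (f a) (factorisations b) _)) ⟩
  (f · (g · h)) m ∎

·-comm : ∀ f g → f · g ≗ g · f
·-comm f g m = trans (splitList-cocomm _ (splitList-cocomm _ splitℕ-cocomm) m _)
  (∑-cong (factorisations m) λ (a , b) → ℚ.*-comm (f b) (g a))

·-identityˡ : ∀ f → 𝟙 · f ≗ f
·-identityˡ f m = trans
  (∑-cong (factorisations m) λ (a , b) → cong (ℚ._* f b) (indicator-all² (_≟ 0) a))
  (splitList-counit _ _ (splitList-counit _ _ splitℕ-counit) m f)

·-∑ : (xs : List A) (ys : List B) (f : A → Series) (g : B → Series) (m : Monomial) →
  ((λ m → ∑ xs λ x → f x m) · (λ m → ∑ ys λ y → g y m)) m ≡ ∑ xs λ x → ∑ ys λ y → (f x · g y) m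
·-∑ xs ys f g m = begin
  (conv factorisations m λ a b → ∑ xs (λ x → f x a) ℚ.* ∑ ys (λ y → g y b))
    ≡⟨ (conv-cong factorisations m λ a b → trans (sym (∑-*ʳ _ xs _)) (∑-cong xs λ x → sym (∑-*ˡ (f x a) ys _))) ⟩
  (conv factorisations m λ a b → ∑ xs λ x → ∑ ys λ y → f x a ℚ.* g y b)
    ≡⟨ ∑-swap (factorisations m) xs _ ⟩
  (∑ xs λ x → conv factorisations m λ a b → ∑ ys λ y → f x a ℚ.* g y b)
    ≡⟨ ∑-cong xs (λ x → ∑-swap (factorisations m) ys _) ⟩
  (∑ xs λ x → ∑ ys λ y → (f x · g y) m) ∎

E-product : List Block → Series
E-product A = foldr _·_ 𝟙 (map (blockSeries E⁺) A)

E-product-++ : ∀ A B → E-product (A ++ B) ≗ E-product A · E-product B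
E-product-++ []      B m = sym (·-identityˡ (E-product B) m)
E-product-++ (x ∷ A) B m = trans
  (·-cong {f = blockSeries E⁺ x} (λ _ → refl) (E-product-++ A B) m)
  (sym (·-assoc (blockSeries E⁺ x) (E-product A) (E-product B) m))

-- The content of a tabloid lists its blocks row by row, whereas a type lists them by multiplicity;
-- the two agree only up to permutation.
E-product-↭ : ∀ {A B} → A ↭ B → E-product A ≗ E-product B
E-product-↭ ↭.refl          m = refl
E-product-↭ (↭.prep x p)    m = ·-cong {f = blockSeries E⁺ x} (λ _ → refl) (E-product-↭ p) m
E-product-↭ {x ∷ y ∷ A} {_ ∷ _ ∷ B} (↭.swap x y p)  m = begin
  (X · (Y · E-product A)) m ≡⟨ ·-assoc X Y (E-product A) m ⟨
  ((X · Y) · E-product A) m ≡⟨ ·-cong {g = E-product A} (·-comm X Y) (E-product-↭ p) m ⟩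
  ((Y · X) · E-product B) m ≡⟨ ·-assoc Y X (E-product B) m ⟩
  (Y · (X · E-product B)) m ∎
  where X = blockSeries E⁺ x
        Y = blockSeries E⁺ y
E-product-↭ (↭.trans p q)   m = trans (E-product-↭ p m) (E-product-↭ q m)

-- One row: 1/(1 - x) = (1 + x) · 1/(1 - x²)

All² : (ℕ → Set) → Monomial → Set
All² P = All (All P)

indicator-¬ : {P : Set} (P? : Dec P) → ¬ P → indicator P? ≡ 0ℚ
indicator-¬ P? ¬p = indicator-false P? λ p → contradiction p ¬p

All²-map : ∀ {P Q : ℕ → Set} (f : ℕ → ℕ) {m} → (∀ {e} → P e → Q (f e)) → All² P m → All² Q (map (map f) m)
All²-map f h = All.map⁺ ∘ All.map (All.map⁺ ∘ All.map h)

root : (r : ℕ) .{{_ : NonZero r}} → Monomial → Monomial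
root r = map (map (ℕ._/ r))

sum-root : ∀ r .{{_ : NonZero r}} {es} → All (r ∣_) es → sum es ≡ r * sum (map (ℕ._/ r) es)
sum-root r []                          = sym (ℕ.*-zeroʳ r)
sum-root r (_∷_ {x = e} {xs = es} r∣e rs) = begin
  e + sum es                                      ≡⟨ cong₂ _+_ (sym (ℕ.m*[n/m]≡n r∣e)) (sum-root r rs) ⟩
  r * (e ℕ./ r) + r * sum (map (ℕ._/ r) es)   ≡⟨ ℕ.*-distribˡ-+ r _ _ ⟨
  r * sum (map (ℕ._/ r) (e ∷ es))                 ∎

weightedSum-root : ∀ r .{{_ : NonZero r}} i {m} → All² (r ∣_) m →
  weightedSum i (map sum m) ≡ r * weightedSum i (map sum (root r m))
weightedSum-root r i []                             = sym (ℕ.*-zeroʳ r)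
weightedSum-root r i (_∷_ {x = es} {xs = m} r∣es rs) = begin
  i * sum es + weightedSum (suc i) (map sum m)
    ≡⟨ cong₂ (λ a b → i * a + b) (sum-root r r∣es) (weightedSum-root r (suc i) rs) ⟩
  i * (r * s) + r * w
    ≡⟨ +-*-Solver.solve 4 (λ i r s w → i :* (r :* s) :+ r :* w := r :* (i :* s :+ w)) refl i r s w ⟩
  r * (i * s + w) ∎
  where open +-*-Solver using (_:*_; _:+_; _:=_)
        s = sum (map (ℕ._/ r) es)
        w = weightedSum (suc i) (map sum (root r m))

deg-root : ∀ r .{{_ : NonZero r}} {m} → All² (r ∣_) m → deg m ≡ r * deg (root r m)
deg-root r = weightedSum-root r 1

ZeroOr : ℕ → ℕ → Set
ZeroOr r e = e ≡ 0 ⊎ e ≡ r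

zeroOr? : ∀ r e → Dec (ZeroOr r e)
zeroOr? r e = (e ≟ 0) ⊎-dec (e ≟ r)

zeroOr⇒∣ : ∀ {r e} → ZeroOr r e → r ∣ e
zeroOr⇒∣ {r} (inj₁ refl) = r ∣0
zeroOr⇒∣ (inj₂ refl) = ∣-refl

-- Closed forms of `H_{d^r}` and `E⁺_{d^r}` that take no root: the degree condition concerns `m`
-- itself, where it is additive over factorisations.
Hʳ Eʳ : ℕ → ℕ → Series
Hʳ r d m = indicator (all? (all? (r ∣?_)) m ×-dec (deg m ≟ r * d))
Eʳ r d m = indicator (all? (all? (zeroOr? r)) m ×-dec (deg m ≟ r * d))

module _ (r : ℕ) .{{_ : NonZero r}} where

  deg-root-≡ : ∀ {m d} → All² (r ∣_) m → deg (root r m) ≡ d → deg m ≡ r * d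
  deg-root-≡ rs refl = deg-root r rs

  deg-root-≡⁻ : ∀ {m d} → All² (r ∣_) m → deg m ≡ r * d → deg (root r m) ≡ d
  deg-root-≡⁻ rs eq = ℕ.*-cancelˡ-≡ _ _ r (trans (sym (deg-root r rs)) eq)

  substPower-H : ∀ d → substPower r (H d) ≗ Hʳ r d
  substPower-H d m with all? (all? (r ∣?_)) m
  ... | no _   = refl
  ... | yes rs = indicator-cong (deg (root r m) ≟ d) (yes rs ×-dec (deg m ≟ r * d))
    (λ eq → rs , deg-root-≡ rs eq) (λ (_ , eq) → deg-root-≡⁻ rs eq)

  /≤1⇒zeroOr : ∀ {e} → r ∣ e → e ℕ./ r ≤ 1 → ZeroOr r e
  /≤1⇒zeroOr {e} r∣e h with e ℕ./ r | ℕ.m*[n/m]≡n {r} {e} r∣e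
  ... | 0 | eq = inj₁ (trans (sym eq) (ℕ.*-zeroʳ r))
  ... | 1 | eq = inj₂ (trans (sym eq) (ℕ.*-identityʳ r))
  ... | suc (suc _) | eq = contradiction h λ { (s≤s ()) }

  zeroOr⇒/≤1 : ∀ {e} → ZeroOr r e → e ℕ./ r ≤ 1
  zeroOr⇒/≤1 (inj₁ refl) = ℕ.≤-trans (ℕ.≤-reflexive (ℕ.0/n≡0 r)) z≤n
  zeroOr⇒/≤1 (inj₂ refl) = ℕ.≤-reflexive (ℕ.n/n≡1 r)

  root⁻ : ∀ {m} → All² (r ∣_) m → All² (_≤ 1) (root r m) → All² (ZeroOr r) m
  root⁻ rs hs = All.zipWith (λ (r∣ , h) → All.zipWith (λ (p , q) → /≤1⇒zeroOr p q) (r∣ , All.map⁻ h)) (rs , All.map⁻ hs)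

  substPower-E : ∀ d → substPower r (E⁺ d) ≗ Eʳ r d
  substPower-E d m with all? (all? (r ∣?_)) m
  ... | no ¬rs  = sym (indicator-¬ (all? (all? (zeroOr? r)) m ×-dec (deg m ≟ r * d))
                    λ (zs , _) → ¬rs (All.map (All.map zeroOr⇒∣) zs))
  ... | yes rs = indicator-cong (deg (root r m) ≟ d ×-dec all? (all? (_≤? 1)) (root r m)) (all? (all? (zeroOr? r)) m ×-dec (deg m ≟ r * d))
    (λ (eq , hs) → root⁻ rs hs , deg-root-≡ rs eq)
    (λ (zs , eq) → deg-root-≡⁻ rs eq , All²-map (ℕ._/ r) zeroOr⇒/≤1 zs)

parity : ∀ q → ∃[ c ] (q ≡ 2 * c ⊎ q ≡ suc (2 * c))
parity zero    = 0 , inj₁ refl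
parity (suc q) with parity q
... | c , inj₁ refl = c , inj₂ refl
... | c , inj₂ refl = suc c , inj₁ (cong suc (sym (ℕ.+-suc c (c + 0))))

-- The coefficient identity (1 + y)(1 + y² + y⁴ + …) = 1 + y + y² + … for y = x^r.
conv-bit : ∀ r .{{_ : NonZero r}} e →
  (conv splitℕ e λ a b → indicator (zeroOr? r a) ℚ.* indicator (2 * r ∣? b)) ≡ indicator (r ∣? e)
conv-bit r e = go (r ∣? e)
  where
  F : ℕ × ℕ → ℚ
  F (a , b) = indicator (zeroOr? r a) ℚ.* indicator (2 * r ∣? b)

  F≡0 : ∀ a b → (ZeroOr r a → ¬ 2 * r ∣ b) → F (a , b) ≡ 0ℚ
  F≡0 a b h = trans (sym (indicator-× (zeroOr? r a) (2 * r ∣? b)))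
    (indicator-¬ (zeroOr? r a ×-dec (2 * r ∣? b)) λ (z , d) → h z d)

  F≡1 : ∀ {a b} → ZeroOr r a → 2 * r ∣ b → F (a , b) ≡ 1ℚ
  F≡1 {a} {b} z d = trans (sym (indicator-× (zeroOr? r a) (2 * r ∣? b)))
    (indicator-true (zeroOr? r a ×-dec (2 * r ∣? b)) (z , d))

  single : ∀ {a b} → a + b ≡ e → ZeroOr r a → 2 * r ∣ b →
    (∀ a′ b′ → a′ + b′ ≡ e → ZeroOr r a′ → 2 * r ∣ b′ → a′ ≡ a) → ∑ (splitℕ e) F ≡ 1ℚ
  single {a} {b} refl z d h = trans (∑-single F (splitℕ-unique e) (splitℕ-complete a b)
    λ (a′ , b′) ∈e ≢ → F≡0 a′ b′ λ z′ d′ → ≢ (sym (lemma a′ b′ (splitℕ-sound e ∈e) (h a′ b′ (splitℕ-sound e ∈e) z′ d′))))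
    (F≡1 z d)
    where
    lemma : ∀ a′ b′ → a′ + b′ ≡ a + b → a′ ≡ a → (a′ , b′) ≡ (a , b)
    lemma a′ b′ eq refl = cong (a ,_) (ℕ.+-cancelˡ-≡ a b′ b eq)

  twice : ∀ c → (2 * c) * r ≡ c * (2 * r)
  twice c = trans (cong (_* r) (ℕ.*-comm 2 c)) (ℕ.*-assoc c 2 r)

  even≢odd-* : ∀ c t → (2 * c) * r ≢ r + t * (2 * r)
  even≢odd-* c t eq = ℕ.even≢odd c t (ℕ.*-cancelʳ-≡ _ _ r (trans eq
    (+-*-Solver.solve 2 (λ r t → r :+ t :* (con 2 :* r) := (con 1 :+ con 2 :* t) :* r) refl r t)))
    where open +-*-Solver using (_:*_; _:+_; _:=_; con)

  go : (d : Dec (r ∣ e)) → ∑ (splitℕ e) F ≡ indicator d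
  go (no r∤e) = ∑-zero (splitℕ e) λ (a , b) ∈e → F≡0 a b λ z d →
    r∤e (subst (r ∣_) (splitℕ-sound e ∈e) (∣m∣n⇒∣m+n (zeroOr⇒∣ z) (∣-trans (n∣m*n 2) d)))
  -- The parity of `e / r` decides the exponent taken from `1 + y`: 0 if it is even, `r` if it is
  -- odd. Exactly one splitting contributes.
  go (yes (divides q refl)) with parity q
  ... | c , inj₁ refl = single {0} refl (inj₁ refl) (divides c (twice c))
    λ { _ _ _ (inj₁ refl) _ → refl
      ; _ _ eq (inj₂ refl) (divides t refl) → contradiction (sym eq) (even≢odd-* c t) }
  ... | c , inj₂ refl = single {r} refl (inj₂ refl) (divides c (twice c))
    λ { _ _ eq (inj₁ refl) (divides t refl) → contradiction
          (trans (twice t) (trans eq (cong (r +_) (twice c)))) (even≢odd-* t c)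
      ; _ _ _ (inj₂ refl) _ → refl }

conv-bit² : ∀ r .{{_ : NonZero r}} m →
  (conv factorisations m λ a b → indicator (all? (all? (zeroOr? r)) a) ℚ.* indicator (all? (all? (2 * r ∣?_)) b))
    ≡ indicator (all? (all? (r ∣?_)) m)
conv-bit² r m = begin
  (conv factorisations m λ a b → indicator (all? (all? (zeroOr? r)) a) ℚ.* indicator (all? (all? (2 * r ∣?_)) b))
    ≡⟨ (conv-cong factorisations m λ a b → cong₂ ℚ._*_ (indicator-all² (zeroOr? r) a) (indicator-all² (2 * r ∣?_) b)) ⟩
  (conv factorisations m λ a b → prod (prod f) a ℚ.* prod (prod g) b)
    ≡⟨ conv-prod (splitList splitℕ) (prod f) (prod g) m ⟩
  prod (λ es → conv (splitList splitℕ) es λ a b → prod f a ℚ.* prod g b) m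
    ≡⟨ prod-cong m (λ es → trans (conv-prod splitℕ f g es) (prod-cong es (conv-bit r))) ⟩
  prod (prod λ e → indicator (r ∣? e)) m
    ≡⟨ indicator-all² (r ∣?_) m ⟨
  indicator (all? (all? (r ∣?_)) m) ∎
  where f g : ℕ → ℚ
        f a = indicator (zeroOr? r a)
        g b = indicator (2 * r ∣? b)

-- Recursion and expansion for one row

splitList-additive : {A : Set} (s : A → List (A × A)) (w : A → ℕ) →
  (∀ x {a b} → (a , b) ∈ s x → w a + w b ≡ w x) →
  ∀ xs {as bs} → (as , bs) ∈ splitList s xs → sum (map w as) + sum (map w bs) ≡ sum (map w xs)
splitList-additive s w h []       (here refl) = refl
splitList-additive s w h (x ∷ xs) p∈ with ∈-cartesianProductWith⁻ _ (s x) (splitList s xs) p∈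
... | (a , b) , (as , bs) , a∈ , as∈ , refl = begin
  (w a + sum (map w as)) + (w b + sum (map w bs)) ≡⟨ solve 4 (λ a b c d → (a :+ b) :+ (c :+ d) := (a :+ c) :+ (b :+ d)) refl (w a) _ (w b) _ ⟩
  (w a + w b) + (sum (map w as) + sum (map w bs)) ≡⟨ cong₂ _+_ (h x a∈) (splitList-additive s w h xs as∈) ⟩
  w x + sum (map w xs) ∎
  where open +-*-Solver

weightedSum-additive : ∀ i m {a b} → (a , b) ∈ factorisations m →
  weightedSum i (map sum a) + weightedSum i (map sum b) ≡ weightedSum i (map sum m)
weightedSum-additive i []       (here refl) = refl
weightedSum-additive i (es ∷ m) p∈ with ∈-cartesianProductWith⁻ _ (splitList splitℕ es) (factorisations m) p∈
... | (as , bs) , (a , b) , as∈ , a∈ , refl = begin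
  (i * sum as + w₁) + (i * sum bs + w₂)
    ≡⟨ solve 5 (λ i s t w₁ w₂ → (i :* s :+ w₁) :+ (i :* t :+ w₂) := i :* (s :+ t) :+ (w₁ :+ w₂)) refl i (sum as) (sum bs) w₁ w₂ ⟩
  i * (sum as + sum bs) + (w₁ + w₂)
    ≡⟨ cong₂ (λ s w → i * s + w) sum-≡ (weightedSum-additive (suc i) m a∈) ⟩
  i * sum es + weightedSum (suc i) (map sum m) ∎
  where
  open +-*-Solver
  open import Data.List.Properties using (map-id)
  w₁ = weightedSum (suc i) (map sum a)
  w₂ = weightedSum (suc i) (map sum b)
  sum-≡ : sum as + sum bs ≡ sum es
  sum-≡ = subst₂ (λ x y → sum x + sum y ≡ sum es) (map-id as) (map-id bs)
    (trans (splitList-additive splitℕ id splitℕ-sound es as∈) (cong sum (map-id es)))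

halves? : ∀ ℓ (p : ℕ × ℕ) → Dec (proj₁ p + 2 * proj₂ p ≡ ℓ)
halves? ℓ (b , c) = b + 2 * c ≟ ℓ

-- With lengths in units of `2 ^ k`, `b` is the part covered by the `k`-brick and `c` is the rest in
-- units of `2 ^ suc k`.
halves : ℕ → List (ℕ × ℕ)
halves ℓ = filter (halves? ℓ) (cartesianProduct (upTo (suc ℓ)) (upTo (suc ℓ)))

halves-unique : ∀ ℓ → Unique (halves ℓ)
halves-unique ℓ = Unique.filter⁺ (halves? ℓ) (Unique.cartesianProduct⁺ (Unique.upTo⁺ (suc ℓ)) (Unique.upTo⁺ (suc ℓ)))

halves-sound : ∀ ℓ {b c} → (b , c) ∈ halves ℓ → b + 2 * c ≡ ℓ
halves-sound ℓ p∈ = proj₂ (∈-filter⁻ (halves? ℓ) {xs = cartesianProduct (upTo (suc ℓ)) (upTo (suc ℓ))} p∈)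

halves-complete : ∀ b c → (b , c) ∈ halves (b + 2 * c)
halves-complete b c = ∈-filter⁺ (halves? (b + 2 * c)) (∈-cartesianProduct⁺
  (∈-upTo⁺ (s≤s (ℕ.m≤m+n b _)))
  (∈-upTo⁺ (s≤s (ℕ.≤-trans (ℕ.m≤m+n c _) (ℕ.m≤n+m _ b))))) refl

-- The homogeneous parts of `conv-bit²`. The degrees of the two factors of a factorisation determine
-- `b` and `c`, so at most one pair contributes to each.
H-recursion : ∀ r .{{_ : NonZero r}} ℓ → Hʳ r ℓ ≗ λ m → ∑ (halves ℓ) λ (b , c) → (Eʳ r b · Hʳ (2 * r) c) m
H-recursion r ℓ m = sym (begin
  (∑ (halves ℓ) λ (b , c) → conv factorisations m λ a a′ → Eʳ r b a ℚ.* Hʳ (2 * r) c a′)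
    ≡⟨ ∑-swap (halves ℓ) (factorisations m) _ ⟩
  (conv factorisations m λ a a′ → ∑ (halves ℓ) λ (b , c) → Eʳ r b a ℚ.* Hʳ (2 * r) c a′)
    ≡⟨ ∑-cong-∈ (factorisations m) (λ (a , a′) a∈ → pointwise a a′ (weightedSum-additive 1 m a∈)) ⟩
  (conv factorisations m λ a a′ → indicator (P? a) ℚ.* indicator (Q? a′) ℚ.* indicator (deg m ≟ r * ℓ))
    ≡⟨ ∑-*ʳ _ (factorisations m) _ ⟩
  (conv factorisations m λ a a′ → indicator (P? a) ℚ.* indicator (Q? a′)) ℚ.* indicator (deg m ≟ r * ℓ)
    ≡⟨ cong (ℚ._* indicator (deg m ≟ r * ℓ)) (conv-bit² r m) ⟩
  indicator (all? (all? (r ∣?_)) m) ℚ.* indicator (deg m ≟ r * ℓ)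
    ≡⟨ indicator-× (all? (all? (r ∣?_)) m) (deg m ≟ r * ℓ) ⟨
  Hʳ r ℓ m ∎)
  where
  P? = all? (all? (zeroOr? r))
  Q? = all? (all? (2 * r ∣?_))
  instance _ = ℕ.m*n≢0 2 r

  distr : ∀ b c → r * b + (2 * r) * c ≡ r * (b + 2 * c)
  distr b c = solve 3 (λ r b c → r :* b :+ (con 2 :* r) :* c := r :* (b :+ con 2 :* c)) refl r b c
    where open +-*-Solver

  term : ∀ a a′ b c → Eʳ r b a ℚ.* Hʳ (2 * r) c a′ ≡
    indicator ((P? a ×-dec (deg a ≟ r * b)) ×-dec (Q? a′ ×-dec (deg a′ ≟ (2 * r) * c)))
  term a a′ b c = sym (indicator-× (P? a ×-dec (deg a ≟ r * b)) (Q? a′ ×-dec (deg a′ ≟ (2 * r) * c)))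

  pointwise : ∀ a a′ → deg a + deg a′ ≡ deg m →
    (∑ (halves ℓ) λ (b , c) → Eʳ r b a ℚ.* Hʳ (2 * r) c a′) ≡
    indicator (P? a) ℚ.* indicator (Q? a′) ℚ.* indicator (deg m ≟ r * ℓ)
  pointwise a a′ deg≡ = trans (helper ((P? a ×-dec Q? a′) ×-dec (deg m ≟ r * ℓ)))
    (trans (indicator-× (P? a ×-dec Q? a′) (deg m ≟ r * ℓ)) (cong (ℚ._* indicator (deg m ≟ r * ℓ)) (indicator-× (P? a) (Q? a′))))
    where
    helper : (d : Dec ((All² (ZeroOr r) a × All² (2 * r ∣_) a′) × deg m ≡ r * ℓ)) →
      (∑ (halves ℓ) λ (b , c) → Eʳ r b a ℚ.* Hʳ (2 * r) c a′) ≡ indicator d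
    helper (no ¬p) = ∑-zero (halves ℓ) λ (b , c) bc∈ → trans (term a a′ b c)
      (indicator-¬ ((P? a ×-dec (deg a ≟ r * b)) ×-dec (Q? a′ ×-dec (deg a′ ≟ (2 * r) * c)))
        λ ((p , eq) , (q , eq′)) → ¬p ((p , q) , (begin
          deg m                                ≡⟨ deg≡ ⟨
          deg a + deg a′                     ≡⟨ cong₂ _+_ eq eq′ ⟩
          r * b + (2 * r) * c          ≡⟨ distr b c ⟩
          r * (b + 2 * c)                ≡⟨ cong (r *_) (halves-sound ℓ bc∈) ⟩
          r * ℓ                              ∎)))
    helper (yes ((p , q) , eq)) = trans
      (∑-single (λ (b , c) → Eʳ r b a ℚ.* Hʳ (2 * r) c a′) (halves-unique ℓ)
        (subst (λ ℓ → (x , y) ∈ halves ℓ) x+2y≡ℓ (halves-complete x y))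
        λ (b , c) _ ≢ → trans (term a a′ b c)
          (indicator-¬ ((P? a ×-dec (deg a ≟ r * b)) ×-dec (Q? a′ ×-dec (deg a′ ≟ (2 * r) * c)))
            λ ((_ , eq₁) , (_ , eq₂)) → ≢ (cong₂ _,_ (deg-root-≡⁻ r p′ eq₁) (deg-root-≡⁻ (2 * r) q eq₂))))
      (trans (term a a′ x y) (indicator-true ((P? a ×-dec (deg a ≟ r * x)) ×-dec (Q? a′ ×-dec (deg a′ ≟ (2 * r) * y)))
        ((p , deg-root r p′) , (q , deg-root (2 * r) q))))
      where
      p′ = All.map (All.map zeroOr⇒∣) p
      -- The pair is forced by `deg a = r b` and `deg a′ = 2 r c`.
      x = deg (root r a)
      y = deg (root (2 * r) a′)
      x+2y≡ℓ : x + 2 * y ≡ ℓ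
      x+2y≡ℓ = ℕ.*-cancelˡ-≡ _ _ r (begin
        r * (x + 2 * y)              ≡⟨ distr x y ⟨
        r * x + (2 * r) * y        ≡⟨ cong₂ _+_ (sym (deg-root r p′)) (sym (deg-root (2 * r) q)) ⟩
        deg a + deg a′                   ≡⟨ deg≡ ⟩
        deg m                              ≡⟨ eq ⟩
        r * ℓ                            ∎)

sum≡0⇒ : ∀ es → sum es ≡ 0 → All (_≡ 0) es
sum≡0⇒ []       _  = []
sum≡0⇒ (e ∷ es) eq = ℕ.m+n≡0⇒m≡0 e eq ∷ sum≡0⇒ es (ℕ.m+n≡0⇒n≡0 e eq)

weightedSum≡0⇒ : ∀ i m → weightedSum (suc i) (map sum m) ≡ 0 → All² (_≡ 0) m
weightedSum≡0⇒ i []       _  = []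
weightedSum≡0⇒ i (es ∷ m) eq =
  sum≡0⇒ es (ℕ.m+n≡0⇒m≡0 (sum es) (ℕ.m+n≡0⇒m≡0 (suc i * sum es) eq)) ∷
  weightedSum≡0⇒ (suc i) m (ℕ.m+n≡0⇒n≡0 (suc i * sum es) eq)

⇒sum≡0 : ∀ {es} → All (_≡ 0) es → sum es ≡ 0
⇒sum≡0 []          = refl
⇒sum≡0 (refl ∷ zs) = ⇒sum≡0 zs

⇒weightedSum≡0 : ∀ i {m} → All² (_≡ 0) m → weightedSum i (map sum m) ≡ 0
⇒weightedSum≡0 i []       = refl
⇒weightedSum≡0 i (z ∷ zs) = cong₂ _+_ (trans (cong (i *_) (⇒sum≡0 z)) (ℕ.*-zeroʳ i)) (⇒weightedSum≡0 (suc i) zs)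

module _ {P : ℕ → Set} (P? : ∀ e → Dec (P e)) (P0 : P 0) where

  -- In degree 0 only the trivial monomial survives, for `H` and `E⁺` alike. This ends the recursion
  -- and removes the factor of an absent brick.
  degree-zero : ∀ r m → indicator (all? (all? P?) m ×-dec (deg m ≟ r * 0)) ≡ 𝟙 m
  degree-zero r m = indicator-cong (all? (all? P?) m ×-dec (deg m ≟ r * 0)) (all? (all? (_≟ 0)) m)
    (λ (_ , eq) → weightedSum≡0⇒ 0 m (trans eq (ℕ.*-zeroʳ r)))
    (λ zs → All.map (All.map λ { refl → P0 }) zs , trans (⇒weightedSum≡0 1 zs) (sym (ℕ.*-zeroʳ r)))

consBrick : ℕ → ℕ → List Brick → List Brick
consBrick k zero    bs = bs
consBrick k (suc b) bs = mkBrick k (suc b) ∷ bs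

-- The increasing rows of length 2^k ℓ with markings ≥ k, provided fuel ≥ ℓ.
rows : (fuel k ℓ : ℕ) → List (List Brick)
rows zero       k ℓ = [ [] ]
rows (suc fuel) k ℓ = concatMap (λ (b , c) → map (consBrick k b) (rows fuel (suc k) c)) (halves ℓ)

-- If `c` is nonzero, then `c < 2 c ≤ ℓ`; if `c = 0`, the bound is trivial, even for `ℓ = 0`. One
-- unit of fuel per marking therefore suffices.
halves-< : ∀ {ℓ g b c} → ℓ ≤ suc g → b + 2 * c ≡ ℓ → c ≤ g
halves-< {c = zero}        _   _    = z≤n
halves-< {b = b} {suc c} ℓ≤g refl = ℕ.s≤s⁻¹ (ℕ.≤-trans (s≤s (ℕ.m≤n+m (suc c) c))
  (ℕ.≤-trans (ℕ.≤-reflexive (cong (λ x → suc (c + x)) (sym (ℕ.+-identityʳ (suc c)))))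
    (ℕ.≤-trans (ℕ.m≤n+m _ b) ℓ≤g)))

-- Unrolls the recursion: marking `k` contributes an `E⁺` factor of multiplicity `2 ^ k * d`, and an
-- `H` factor of doubled multiplicity passes to marking `suc k`. When the fuel runs out, `ℓ = 0` and
-- the remaining factor is 1, which truncates the infinite product.
H-rows : ∀ g k ℓ (d : ℕ) .{{_ : NonZero d}} → ℓ ≤ g →
  Hʳ (2 ^ k * d) ℓ ≗ λ m → ∑ (rows g k ℓ) λ row → E-product (map (brickBlock d) row) m
H-rows zero    k .zero d z≤n m = trans
  (degree-zero ((2 ^ k * d) ∣?_) ((2 ^ k * d) ∣0) (2 ^ k * d) m) (sym (ℚ.+-identityʳ _))
H-rows (suc g) k ℓ d ℓ≤g m = begin
  Hʳ r ℓ m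
    ≡⟨ H-recursion r ℓ m ⟩
  (∑ (halves ℓ) λ (b , c) → (Eʳ r b · Hʳ (2 * r) c) m)
    ≡⟨ ∑-cong-∈ (halves ℓ) (λ (b , c) bc∈ → step b c (halves-< {b = b} ℓ≤g (halves-sound ℓ bc∈))) ⟩
  (∑ (halves ℓ) λ (b , c) → ∑ (map (consBrick k b) (rows g (suc k) c)) λ row → E-product (map (brickBlock d) row) m)
    ≡⟨ ∑-concatMap _ (halves ℓ) _ ⟨
  (∑ (rows (suc g) k ℓ) λ row → E-product (map (brickBlock d) row) m) ∎
  where
  r = 2 ^ k * d
  instance
    _ = ℕ.m^n≢0 2 k
    r≢0 = ℕ.m*n≢0 (2 ^ k) d

  cons-brick : ∀ b row → Eʳ r b · E-product (map (brickBlock d) row) ≗ E-product (map (brickBlock d) (consBrick k b row))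
  cons-brick zero row m = trans
    (·-cong {g = E-product (map (brickBlock d) row)} (degree-zero (zeroOr? r) (inj₁ refl) r) (λ _ → refl) m)
    (·-identityˡ (E-product (map (brickBlock d) row)) m)
  cons-brick (suc b) row m =
    ·-cong {g = E-product (map (brickBlock d) row)} (λ a → sym (substPower-E r (suc b) a)) (λ _ → refl) m

  step : ∀ b c → c ≤ g → (Eʳ r b · Hʳ (2 * r) c) m ≡
    ∑ (map (consBrick k b) (rows g (suc k) c)) λ row → E-product (map (brickBlock d) row) m
  step b c c≤g = begin
    (Eʳ r b · Hʳ (2 * r) c) m
      -- The left factor is rewritten as a sum over `[ b ]` so that the bilinearity lemma `·-∑`
      -- applies.
      ≡⟨ ·-cong (λ a → sym (ℚ.+-identityʳ (Eʳ r b a)))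
           (λ a → trans (cong (λ q → Hʳ q c a) (sym (ℕ.*-assoc 2 (2 ^ k) d))) (H-rows g (suc k) c d c≤g a)) m ⟩
    ((λ m → ∑ [ b ] λ b → Eʳ r b m) · (λ m → ∑ (rows g (suc k) c) λ row → E-product (map (brickBlock d) row) m)) m
      ≡⟨ ·-∑ [ b ] (rows g (suc k) c) (Eʳ r) (λ row → E-product (map (brickBlock d) row)) m ⟩
    (∑ [ b ] λ b → ∑ (rows g (suc k) c) λ row → (Eʳ r b · E-product (map (brickBlock d) row)) m)
      ≡⟨ ℚ.+-identityʳ _ ⟩
    (∑ (rows g (suc k) c) λ row → (Eʳ r b · E-product (map (brickBlock d) row)) m)
      ≡⟨ ∑-cong (rows g (suc k) c) (λ row → cons-brick b row m) ⟩
    (∑ (rows g (suc k) c) λ row → E-product (map (brickBlock d) (consBrick k b row)) m)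
      ≡⟨ ∑-map (consBrick k b) (rows g (suc k) c) _ ⟨
    (∑ (map (consBrick k b) (rows g (suc k) c)) λ row → E-product (map (brickBlock d) row) m) ∎

-- Enumeration of distinct tabloids

AllPairs-map-∈ : {R S : A → A → Set} {xs : List A} → (∀ {x y} → x ∈ xs → y ∈ xs → R x y → S x y) →
  AllPairs R xs → AllPairs S xs
AllPairs-map-∈ h []         = []
AllPairs-map-∈ h (rx ∷ rxs) =
  All.tabulate (λ y∈ → h (here refl) (there y∈) (All.lookup rx y∈)) ∷
  AllPairs-map-∈ (λ x∈ y∈ → h (there x∈) (there y∈)) rxs

rowLength : List Brick → ℕ
rowLength bs = sum (map brickLength bs)

Increasing : List Brick → Set
Increasing = AllPairs λ x y → marking x < marking y

MarkedFrom : ℕ → List Brick → Set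
MarkedFrom k = All λ x → k ≤ marking x

rowLength-cons : ∀ k b bs → rowLength (consBrick k b bs) ≡ 2 ^ k * b + rowLength bs
rowLength-cons k zero    bs = cong (_+ rowLength bs) (sym (ℕ.*-zeroʳ (2 ^ k)))
rowLength-cons k (suc b) bs = refl

2^k*-cons : ∀ k b c → 2 ^ k * b + 2 ^ suc k * c ≡ 2 ^ k * (b + 2 * c)
2^k*-cons k b c = solve 3 (λ p b c → p :* b :+ (con 2 :* p) :* c := p :* (b :+ con 2 :* c)) refl (2 ^ k) b c
  where open +-*-Solver

∈-rows-suc⁻ : ∀ g k ℓ {row} → row ∈ rows (suc g) k ℓ →
  ∃[ b ] ∃[ c ] ∃[ row′ ] b + 2 * c ≡ ℓ × row′ ∈ rows g (suc k) c × row ≡ consBrick k b row′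
∈-rows-suc⁻ g k ℓ row∈ with ∈-concat⁻′ (map (λ (b , c) → map (consBrick k b) (rows g (suc k) c)) (halves ℓ)) row∈
... | rs , row∈rs , rs∈ with ∈-map⁻ (λ (b , c) → map (consBrick k b) (rows g (suc k) c)) rs∈
...   | (b , c) , bc∈ , refl with ∈-map⁻ (consBrick k b) row∈rs
...     | row′ , row′∈ , eq = b , c , row′ , halves-sound ℓ bc∈ , row′∈ , eq

∈-rows-suc⁺ : ∀ g k b c {row} → row ∈ rows g (suc k) c → consBrick k b row ∈ rows (suc g) k (b + 2 * c)
∈-rows-suc⁺ g k b c row∈ = ∈-concat⁺′ (∈-map⁺ (consBrick k b) row∈) (∈-map⁺ _ (halves-complete b c))

consBrick-increasing : ∀ k b {row} → MarkedFrom (suc k) row → Increasing row → Increasing (consBrick k b row)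
consBrick-increasing k zero    ms incr = incr
consBrick-increasing k (suc b) ms incr = ms ∷ incr

consBrick-marked : ∀ k b {row} → MarkedFrom (suc k) row → MarkedFrom k (consBrick k b row)
consBrick-marked k zero    ms = All.map ℕ.<⇒≤ ms
consBrick-marked k (suc b) ms = ℕ.≤-refl ∷ All.map ℕ.<⇒≤ ms

rows-marked : ∀ g k ℓ {row} → row ∈ rows g k ℓ → MarkedFrom k row
rows-marked zero    k ℓ (here refl) = []
rows-marked (suc g) k ℓ row∈ with ∈-rows-suc⁻ g k ℓ row∈
... | b , c , _ , _ , row′∈ , refl = consBrick-marked k b (rows-marked g (suc k) c row′∈)

rows-increasing : ∀ g k ℓ {row} → row ∈ rows g k ℓ → Increasing row
rows-increasing zero    k ℓ (here refl) = []
rows-increasing (suc g) k ℓ row∈ with ∈-rows-suc⁻ g k ℓ row∈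
... | b , c , _ , _ , row′∈ , refl =
  consBrick-increasing k b (rows-marked g (suc k) c row′∈) (rows-increasing g (suc k) c row′∈)

rows-length : ∀ g k ℓ {row} → ℓ ≤ g → row ∈ rows g k ℓ → rowLength row ≡ 2 ^ k * ℓ
rows-length zero    k .zero z≤n (here refl) = sym (ℕ.*-zeroʳ (2 ^ k))
rows-length (suc g) k ℓ ℓ≤g row∈ with ∈-rows-suc⁻ g k ℓ row∈
... | b , c , row′ , refl , row′∈ , refl = begin
  rowLength (consBrick k b row′)    ≡⟨ rowLength-cons k b row′ ⟩
  2 ^ k * b + rowLength row′        ≡⟨ cong (2 ^ k * b +_) (rows-length g (suc k) c (halves-< {b = b} ℓ≤g refl) row′∈) ⟩
  2 ^ k * b + 2 ^ suc k * c         ≡⟨ 2^k*-cons k b c ⟩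
  2 ^ k * (b + 2 * c)               ∎

-- Shows that `consBrick` reaches every increasing row: either the first brick carries marking `k`,
-- or all markings exceed `k` and `b = 0`.
uncons-row : ∀ k row → MarkedFrom k row → Increasing row →
  ∃[ b ] ∃[ row′ ] row ≡ consBrick k b row′ × MarkedFrom (suc k) row′ × Increasing row′
uncons-row k []                         []        []            = 0 , [] , refl , [] , []
uncons-row k (mkBrick k′ zero {{()}} ∷ row) _ _
uncons-row k (mkBrick k′ (suc b) ∷ row) (k≤ ∷ ms) (incr ∷ incrs) with k ≟ k′
... | yes refl = suc b , row , refl , incr , incrs
... | no  k≢   = 0 , _ , refl , (ℕ.≤∧≢⇒< k≤ k≢ ∷ All.map (λ lt → ℕ.≤-<-trans k≤ lt) incr) , incr ∷ incrs

^-monoʳ-∣ : ∀ m {k l} → k ≤ l → m ^ k ∣ m ^ l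
^-monoʳ-∣ m {k} {l} k≤l = divides (m ^ (l ∸ k))
  (trans (cong (m ^_) (sym (ℕ.m∸n+n≡m k≤l))) (ℕ.^-distribˡ-+-* m (l ∸ k) k))

-- Supplies the `c` of `rows-complete`: once the `k`-brick is removed, the remaining length is a
-- multiple of `2 ^ suc k`.
marked⇒2^∣ : ∀ k {row} → MarkedFrom k row → 2 ^ k ∣ rowLength row
marked⇒2^∣ k []                                  = (2 ^ k) ∣0
marked⇒2^∣ k (_∷_ {x = mkBrick k′ b} k≤ ms) =
  ∣m∣n⇒∣m+n (∣-trans (^-monoʳ-∣ 2 k≤) (m∣m*n b)) (marked⇒2^∣ k ms)

rowLength≡0⇒ : ∀ row → rowLength row ≡ 0 → row ≡ []
rowLength≡0⇒ []                            _  = refl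
rowLength≡0⇒ (mkBrick k zero {{()}} ∷ _) _
rowLength≡0⇒ (mkBrick k (suc b) ∷ row)  eq with ℕ.m*n≡0⇒m≡0 (2 ^ k) (suc b) (ℕ.m+n≡0⇒m≡0 (2 ^ k * suc b) eq)
... | 2^k≡0 with ℕ.m^n≡0⇒m≡0 2 k 2^k≡0
...   | ()

rows-complete : ∀ g k ℓ {row} → ℓ ≤ g → MarkedFrom k row → Increasing row → rowLength row ≡ 2 ^ k * ℓ → row ∈ rows g k ℓ
rows-complete zero    k .zero {row} z≤n _ _ eq = here (rowLength≡0⇒ row (trans eq (ℕ.*-zeroʳ (2 ^ k))))
rows-complete (suc g) k ℓ {row} ℓ≤g ms incr eq with uncons-row k row ms incr
... | b , row′ , refl , ms′ , incr′ with marked⇒2^∣ (suc k) ms′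
...   | divides c eq′ = subst (λ ℓ → consBrick k b row′ ∈ rows (suc g) k ℓ) b+2c≡ℓ
          (∈-rows-suc⁺ g k b c (rows-complete g (suc k) c (halves-< {b = b} ℓ≤g b+2c≡ℓ) ms′ incr′ length′))
  where
  instance _ = ℕ.m^n≢0 2 k
  length′ : rowLength row′ ≡ 2 ^ suc k * c
  length′ = trans eq′ (ℕ.*-comm c (2 ^ suc k))
  b+2c≡ℓ : b + 2 * c ≡ ℓ
  b+2c≡ℓ = ℕ.*-cancelˡ-≡ _ _ (2 ^ k) (begin
    2 ^ k * (b + 2 * c)             ≡⟨ 2^k*-cons k b c ⟨
    2 ^ k * b + 2 ^ suc k * c       ≡⟨ cong (2 ^ k * b +_) length′ ⟨
    2 ^ k * b + rowLength row′      ≡⟨ rowLength-cons k b row′ ⟨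
    rowLength (consBrick k b row′)  ≡⟨ eq ⟩
    2 ^ k * ℓ                       ∎)

consBrick-injectiveʳ : ∀ k b {row row′} → consBrick k b row ≡ consBrick k b row′ → row ≡ row′
consBrick-injectiveʳ k zero    eq = eq
consBrick-injectiveʳ k (suc b) eq = ∷-injectiveʳ eq

-- The bounds on the tails make `b` recoverable: a `k`-brick at the front cannot belong to the tail.
consBrick-injectiveˡ : ∀ k b b′ {row row′} → MarkedFrom (suc k) row → MarkedFrom (suc k) row′ →
  consBrick k b row ≡ consBrick k b′ row′ → b ≡ b′
consBrick-injectiveˡ k zero    zero     _        _        _    = refl
consBrick-injectiveˡ k zero    (suc b′) (k< ∷ _) _        refl = contradiction k< (ℕ.n≮n k)
consBrick-injectiveˡ k (suc b) zero     _        (k< ∷ _) refl = contradiction k< (ℕ.n≮n k)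
consBrick-injectiveˡ k (suc b) (suc b′) _        _        eq   = cong (Brick.b) (proj₁ (∷-injective eq))

rows-unique : ∀ g k ℓ → Unique (rows g k ℓ)
rows-unique zero    k ℓ = [] ∷ []
rows-unique (suc g) k ℓ = Unique.concat⁺
  (All.map⁺ (All.tabulate λ {(b , c)} _ → Unique.map⁺ (consBrick-injectiveʳ k b) (rows-unique g (suc k) c)))
  (AllPairs.map⁺ (AllPairs-map-∈ (λ {(b , c)} {(b′ , c′)} → disjoint b c b′ c′) (halves-unique ℓ)))
  where
  disjoint : ∀ b c b′ c′ → (b , c) ∈ halves ℓ → (b′ , c′) ∈ halves ℓ → (b , c) ≢ (b′ , c′) →
    ∀ {row} → ¬ (row ∈ map (consBrick k b) (rows g (suc k) c) × row ∈ map (consBrick k b′) (rows g (suc k) c′))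
  disjoint b c b′ c′ ∈h ∈h′ ≢ (row∈ , row∈′) with ∈-map⁻ _ row∈ | ∈-map⁻ _ row∈′
  ... | _ , p , refl | _ , p′ , eq
    with consBrick-injectiveˡ k b b′ (rows-marked g (suc k) c p) (rows-marked g (suc k) c′ p′) eq
  -- Equal `b` forces equal `c`, since `b + 2 * c` is `ℓ` for both pairs.
  ...   | refl = ≢ (cong (b ,_) (ℕ.*-cancelˡ-≡ c c′ 2
                   (ℕ.+-cancelˡ-≡ b _ _ (trans (halves-sound ℓ ∈h) (sym (halves-sound ℓ ∈h′))))))

-- Distinct tilings stripped of the proofs that they fill and order the rows; as bare lists they can
-- be enumerated and counted.
codes : List Block → List (List (List Brick))
codes []                 = [ [] ]
codes (mkBlock d _ ∷ Bs) = cartesianProductWith _∷_ (rows d 0 d) (codes Bs)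

codes-unique : ∀ Bs → Unique (codes Bs)
codes-unique []                 = [] ∷ []
codes-unique (mkBlock d _ ∷ Bs) = Unique.cartesianProductWith⁺ _∷_ ∷-injective (rows-unique d 0 d) (codes-unique Bs)

codeContent : List Block → List (List Brick) → List Block
codeContent (mkBlock _ m ∷ Bs) (row ∷ c) = map (brickBlock m) row ++ codeContent Bs c
codeContent _                  _         = []

H-codes : ∀ Bs → foldr _·_ 𝟙 (map (blockSeries H) Bs) ≗ λ m → ∑ (codes Bs) λ c → E-product (codeContent Bs c) m
H-codes []                   m = sym (ℚ.+-identityʳ _)
H-codes (mkBlock d r ∷ Bs) m = begin
  (substPower r (H d) · foldr _·_ 𝟙 (map (blockSeries H) Bs)) m
    ≡⟨ ·-cong H-row (H-codes Bs) m ⟩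
  ((λ m → ∑ (rows d 0 d) λ row → E-product (map (brickBlock r) row) m) ·
   (λ m → ∑ (codes Bs) λ c → E-product (codeContent Bs c) m)) m
    ≡⟨ ·-∑ (rows d 0 d) (codes Bs) _ _ m ⟩
  (∑ (rows d 0 d) λ row → ∑ (codes Bs) λ c → (E-product (map (brickBlock r) row) · E-product (codeContent Bs c)) m)
    ≡⟨ ∑-cong (rows d 0 d) (λ row → ∑-cong (codes Bs) λ c → sym (E-product-++ (map (brickBlock r) row) (codeContent Bs c) m)) ⟩
  (∑ (rows d 0 d) λ row → ∑ (codes Bs) λ c → E-product (map (brickBlock r) row ++ codeContent Bs c) m)
    ≡⟨ ∑-× _∷_ (rows d 0 d) (codes Bs) _ ⟨
  (∑ (cartesianProductWith _∷_ (rows d 0 d) (codes Bs)) λ c → E-product (codeContent (mkBlock d r ∷ Bs) c) m) ∎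
  where
  H-row : substPower r (H d) ≗ λ m → ∑ (rows d 0 d) λ row → E-product (map (brickBlock r) row) m
  H-row m = trans (substPower-H r d m) (trans (cong (λ q → Hʳ q d m) (sym (ℕ.*-identityˡ r)))
    (H-rows d 0 d r ℕ.≤-refl m))

blockWeight : Block → ℕ
blockWeight (mkBlock d r) = d * r

wt : List Block → ℕ
wt A = sum (map blockWeight A)

wt-++ : ∀ A B → wt (A ++ B) ≡ wt A + wt B
wt-++ A B = trans (cong sum (map-++ blockWeight A B)) (sum-++ (map blockWeight A) (map blockWeight B))

wt-row : ∀ m .{{_ : NonZero m}} row → wt (map (brickBlock m) row) ≡ rowLength row * m
wt-row m []                  = refl
wt-row m (mkBrick k b ∷ row) = trans (cong₂ _+_
  (solve 3 (λ p b m → b :* (p :* m) := p :* b :* m) refl (2 ^ k) b m) (wt-row m row))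
  (sym (ℕ.*-distribʳ-+ m (2 ^ k * b) (rowLength row)))
  where open +-*-Solver

-- A brick of length `2 ^ k * b` in a row of multiplicity `m` becomes a block of weight
-- `b * (2 ^ k * m)`, which is its length times `m`. Hence the content is again a type of the same
-- `n`.
wt-codeContent : ∀ Bs {c} → c ∈ codes Bs → wt (codeContent Bs c) ≡ wt Bs
wt-codeContent []                 (here refl) = refl
wt-codeContent (mkBlock d m ∷ Bs) c∈ with ∈-cartesianProductWith⁻ _∷_ (rows d 0 d) (codes Bs) c∈
... | row , c , row∈ , c∈′ , refl = trans (wt-++ (map (brickBlock m) row) _) (cong₂ _+_
  (trans (wt-row m row) (cong (_* m) (trans (rows-length d 0 d ℕ.≤-refl row∈) (ℕ.*-identityˡ d))))
  (wt-codeContent Bs c∈′))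

Positive : Block → Set
Positive B = NonZero (Block.degree B)

brickBlock-positive : ∀ m .{{_ : NonZero m}} x → Positive (brickBlock m x)
brickBlock-positive m (mkBrick k (suc b)) = _
brickBlock-positive m (mkBrick k zero {{()}})

codeContent-positive : ∀ Bs c → All Positive (codeContent Bs c)
codeContent-positive []                 c         = []
codeContent-positive (_ ∷ _)            []        = []
codeContent-positive (mkBlock _ m ∷ Bs) (row ∷ c) =
  All.++⁺ (All.map⁺ (All.universal (brickBlock-positive m) row)) (codeContent-positive Bs c)

RowTilings : List Block → Set
RowTilings = All (λ r → RowTiling (Block.degree r))

DistinctRows : List (List Brick) → Set
DistinctRows = All (λ row → Unique (map marking row))

distinctRows? : ∀ rs → Dec (DistinctRows rs)
distinctRows? = all? λ row → allPairs? (λ x y → ¬? (x ≟ y)) (map marking row)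

-- Weakly increasing and pairwise distinct markings are strictly increasing. The irrelevant proofs
-- are recovered by `recompute`, the conditions being decidable.
rowTiling∈rows : ∀ {ℓ} (t : RowTiling ℓ) → Unique (map marking (bricks t)) → bricks t ∈ rows ℓ 0 ℓ
rowTiling∈rows {ℓ} (mkRowTiling bs fills ordered) uniq = rows-complete ℓ 0 ℓ ℕ.≤-refl (All.universal (λ _ → z≤n) bs)
  (AllPairs.zipWith (λ (le , ne) → ℕ.≤∧≢⇒< le ne)
    (recompute (allPairs? (λ x y → marking x ≤? marking y) bs) ordered , AllPairs.map⁻ uniq))
  (trans (recompute (rowLength bs ≟ ℓ) fills) (sym (ℕ.*-identityˡ ℓ)))

tilings∈codes : ∀ {Bs} (T : RowTilings Bs) → DistinctRows (reduce bricks T) → reduce bricks T ∈ codes Bs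
tilings∈codes []                        []           = here refl
tilings∈codes {mkBlock d _ ∷ _} (t ∷ T) (uniq ∷ dist) =
  ∈-cartesianProductWith⁺ _∷_ (rowTiling∈rows t uniq) (tilings∈codes T dist)

codes-tiling : ∀ Bs {c} → c ∈ codes Bs → ∃[ T ] reduce {P = λ r → RowTiling (Block.degree r)} {xs = Bs} bricks T ≡ c × DistinctRows c
codes-tiling []                 (here refl) = [] , refl , []
codes-tiling (mkBlock d m ∷ Bs) c∈ with ∈-cartesianProductWith⁻ _∷_ (rows d 0 d) (codes Bs) c∈
... | row , c , row∈ , c∈′ , refl with codes-tiling Bs c∈′
...   | T , refl , dist =
  mkRowTiling row (trans (rows-length d 0 d ℕ.≤-refl row∈) (ℕ.*-identityˡ d))
    (AllPairs.map ℕ.<⇒≤ (rows-increasing d 0 d row∈)) ∷ T ,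
  refl , AllPairs.map⁺ (AllPairs.map ℕ.<⇒≢ (rows-increasing d 0 d row∈)) ∷ dist

reduce-bricks-injective : ∀ {Bs} (T T′ : RowTilings Bs) → reduce bricks T ≡ reduce bricks T′ → T ≡ T′
reduce-bricks-injective []      []        _  = refl
reduce-bricks-injective (t ∷ T) (t′ ∷ T′) eq =
  cong₂ _∷_ (bricks-injective (proj₁ (∷-injective eq))) (reduce-bricks-injective T T′ (∷-injectiveʳ eq))
  where
  bricks-injective : ∀ {ℓ} {t t′ : RowTiling ℓ} → bricks t ≡ bricks t′ → t ≡ t′
  bricks-injective refl = refl

-- Stated for an arbitrary `f` because the block function inside `content` is local to it and has no
-- name here; unification finds it in `content-code`.
content≡codeContent : (f : Block → Brick → Block) → (∀ d m .{{_ : NonZero m}} x → f (mkBlock d m) x ≡ brickBlock m x) →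
  ∀ {Bs} (T : RowTilings Bs) → concat (reduce (λ {r} t → map (f r) (bricks t)) T) ≡ codeContent Bs (reduce bricks T)
content≡codeContent f f≡ []                        = refl
content≡codeContent f f≡ {mkBlock d m ∷ _} (t ∷ T) =
  cong₂ _++_ (map-cong (f≡ d m) (bricks t)) (content≡codeContent f f≡ T)

content-code : ∀ {n} (σ : Typ n) (T : Tiling σ) → content {σ = σ} T ≡ codeContent (blocks σ) (rowBricks {σ = σ} T)
content-code σ T = content≡codeContent _ (λ _ _ _ → refl) T

-- Counting through a list without repetitions

unique⇒lookup-injective : {xs : List A} → Unique xs → ∀ {i j} → lookup xs i ≡ lookup xs j → i ≡ j
unique⇒lookup-injective (x∉ ∷ xs!) {Fin.zero}  {Fin.zero}  _  = refl
unique⇒lookup-injective (x∉ ∷ xs!) {Fin.zero}  {Fin.suc j} eq = contradiction eq (All.lookup x∉ (∈-lookup j))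
unique⇒lookup-injective (x∉ ∷ xs!) {Fin.suc i} {Fin.zero}  eq = contradiction (sym eq) (All.lookup x∉ (∈-lookup i))
unique⇒lookup-injective (x∉ ∷ xs!) {Fin.suc i} {Fin.suc j} eq = cong Fin.suc (unique⇒lookup-injective xs! eq)

↔Fin-length : (f : A → C) → (∀ {a a′} → f a ≡ f a′ → a ≡ a′) → {xs : List C} → Unique xs →
  (∀ a → f a ∈ xs) → (∀ {c} → c ∈ xs → ∃[ a ] f a ≡ c) → A ↔ Fin (length xs)
↔Fin-length f f-inj {xs} xs! to-∈ from-∈ = mk↔ₛ′ (index ∘ to-∈) (proj₁ ∘ from)
  (λ i → unique⇒lookup-injective xs! (trans (sym (Any.lookup-index (to-∈ _))) (proj₂ (from i))))
  (λ a → f-inj (trans (proj₂ (from _)) (sym (Any.lookup-index (to-∈ a)))))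
  where
  from : ∀ i → ∃[ a ] f a ≡ lookup xs i
  from i = from-∈ (∈-lookup i)

-- Types as multisets of blocks

infix 4 _≟ᴮ_
_≟ᴮ_ : DecidableEquality Block
mkBlock d r ≟ᴮ mkBlock d′ r′ = map′ (λ { (refl , refl) → refl }) (λ { refl → refl , refl }) (d ≟ d′ ×-dec r ≟ r′)

module _ (_≟ᴬ_ : DecidableEquality A) where

  open import Data.List.Membership.DecPropositional _≟ᴬ_ using (_∈?_)

  _↭?_ : ∀ (xs ys : List A) → Dec (xs ↭ ys)
  []       ↭? []      = yes ↭-refl
  []       ↭? (_ ∷ _) = no λ p → ↭.¬x∷xs↭[] (↭-sym p)
  (x ∷ xs) ↭? ys with x ∈? ys
  ... | no  x∉ = no λ p → x∉ (↭.∈-resp-↭ p (here refl))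
  ... | yes x∈ with ∈-∃++ x∈
  ...   | as , bs , refl = map′
    (λ p → ↭-trans (↭.prep x p) (↭-sym (↭.shift x as bs)))
    (λ p → ↭.drop-∷ (↭-trans p (↭.shift x as bs)))
    (xs ↭? (as ++ bs))

infix 4 _↭ᴮ?_
_↭ᴮ?_ : ∀ A B → Dec (A ↭ B)
_↭ᴮ?_ = _↭?_ _≟ᴮ_

multiplicity? : ∀ i (B : Block) → Dec (Block.multiplicity B ≡ i)
multiplicity? i B = Block.multiplicity B ≟ i

map-degree : ∀ i .{{_ : NonZero i}} ds → map Block.degree (map (λ d → mkBlock d i) ds) ≡ ds
map-degree i ds = trans (sym (map-∘ ds)) (map-id ds)

map-mkBlock : ∀ i .{{_ : NonZero i}} {A} → All (λ B → Block.multiplicity B ≡ i) A →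
  map (λ d → mkBlock d i) (map Block.degree A) ≡ A
map-mkBlock i []          = refl
map-mkBlock i (refl ∷ ms) = cong (_ ∷_) (map-mkBlock i ms)

blocksFrom-≥ : ∀ {k} i .{{_ : NonZero i}} (ps : Vec Partition k) → All (λ B → i ≤ Block.multiplicity B) (blocksFrom i ps)
blocksFrom-≥ i []       = []
blocksFrom-≥ i (p ∷ ps) = All.++⁺ (All.map⁺ (All.universal (λ _ → ℕ.≤-refl) (parts p)))
  (All.map ℕ.<⇒≤ (blocksFrom-≥ (suc i) ps))

module _ {k} i .{{_ : NonZero i}} (p : Partition) (ps : Vec Partition k) where

  private
    Bs  = map (λ d → mkBlock d i) (parts p)
    Bs′ = blocksFrom (suc i) ps
    multiplicity≡ : All (λ B → Block.multiplicity B ≡ i) Bs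
    multiplicity≡ = All.map⁺ (All.universal (λ _ → refl) (parts p))
    multiplicity≢ : All (λ B → Block.multiplicity B ≢ i) Bs′
    multiplicity≢ = All.map (λ i< eq → ℕ.<⇒≢ i< (sym eq)) (blocksFrom-≥ (suc i) ps)

  filter-head : filter (multiplicity? i) (blocksFrom i (p ∷ ps)) ≡ map (λ d → mkBlock d i) (parts p)
  filter-head = trans (filter-++ (multiplicity? i) Bs Bs′)
    (trans (cong₂ _++_ (filter-all (multiplicity? i) multiplicity≡) (filter-none (multiplicity? i) multiplicity≢))
      (++-identityʳ Bs))

  filter-tail : filter (¬? ∘ multiplicity? i) (blocksFrom i (p ∷ ps)) ≡ blocksFrom (suc i) ps
  filter-tail = trans (filter-++ (¬? ∘ multiplicity? i) Bs Bs′)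
    (cong₂ _++_ (filter-none (¬? ∘ multiplicity? i) (All.map (λ eq ≢ → ≢ eq) multiplicity≡))
      (filter-all (¬? ∘ multiplicity? i) multiplicity≢))

≥-decTotalOrder : DecTotalOrder _ _ _
≥-decTotalOrder = Flip.decTotalOrder ℕ.≤-decTotalOrder

module ≥-Sort = Sort ≥-decTotalOrder

parts-injective : ∀ {p q} → parts p ≡ parts q → p ≡ q
parts-injective refl = refl

parts-↭ : ∀ {p q} → parts p ↭ parts q → p ≡ q
parts-↭ {mkPartition ds _ dec} {mkPartition es _ dec′} ds↭es = parts-injective
  (Pointwise-≡⇒≡ (↗↭↗⇒≋ (DecTotalOrder.totalOrder ≥-decTotalOrder)
    (recompute (linked? _≥?_ ds) dec) (recompute (linked? _≥?_ es) dec′) (↭⇒↭ₛ ds↭es)))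

-- The blocks of multiplicity `i` recover the degrees of the first partition as a multiset, and a
-- decreasing list is determined by its multiset of entries. The other blocks have larger
-- multiplicity and are handled by induction.
blocksFrom-injective : ∀ {k} i .{{_ : NonZero i}} (ps qs : Vec Partition k) → blocksFrom i ps ↭ blocksFrom i qs → ps ≡ qs
blocksFrom-injective i []       []       _ = refl
blocksFrom-injective i (p ∷ ps) (q ∷ qs) h = cong₂ _∷_
  (parts-↭ (subst₂ _↭_ (map-degree i (parts p)) (map-degree i (parts q))
    (↭.map⁺ Block.degree (subst₂ _↭_ (filter-head i p ps) (filter-head i q qs) (↭.filter-↭ (multiplicity? i) h)))))
  (blocksFrom-injective (suc i) ps qs
    (subst₂ _↭_ (filter-tail i p ps) (filter-tail i q qs) (↭.filter-↭ (¬? ∘ multiplicity? i) h)))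

factors-injective : ∀ {n} {σ τ : Typ n} → factors σ ≡ factors τ → σ ≡ τ
factors-injective refl = refl

blocks-injective : ∀ {n} {σ τ : Typ n} → blocks σ ↭ blocks τ → σ ≡ τ
blocks-injective {σ = σ} {τ} h = factors-injective (blocksFrom-injective 1 (factors σ) (factors τ) h)

infix 4 _≟ᵀ_
_≟ᵀ_ : ∀ {n} → DecidableEquality (Typ n)
σ ≟ᵀ τ = map′ blocks-injective (λ { refl → ↭-refl }) (blocks σ ↭ᴮ? blocks τ)

wt-blocksFrom : ∀ {k} i .{{_ : NonZero i}} (ps : Vec Partition k) →
  wt (blocksFrom i ps) ≡ weightedSum i (map size (toList ps))
wt-blocksFrom i []       = refl
wt-blocksFrom i (p ∷ ps) = trans (wt-++ (map (λ d → mkBlock d i) (parts p)) (blocksFrom (suc i) ps))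
  (cong₂ _+_ (wt-column (parts p)) (wt-blocksFrom (suc i) ps))
  where
  wt-column : ∀ ds → wt (map (λ d → mkBlock d i) ds) ≡ i * sum ds
  wt-column []       = sym (ℕ.*-zeroʳ i)
  wt-column (d ∷ ds) = trans (cong₂ _+_ (ℕ.*-comm d i) (wt-column ds)) (sym (ℕ.*-distribˡ-+ i d (sum ds)))

wt-blocks : ∀ {n} (σ : Typ n) → wt (blocks σ) ≡ n
wt-blocks (mkTyp ps weight) = trans (wt-blocksFrom 1 ps) (recompute (_ ≟ _) weight)

blocksFrom-positive : ∀ {k} i .{{_ : NonZero i}} (ps : Vec Partition k) → All Positive (blocksFrom i ps)
blocksFrom-positive i []                           = []
blocksFrom-positive i (mkPartition ds pos _ ∷ ps) =
  All.++⁺ (All.map⁺ (recompute (all? nonZero? ds) pos)) (blocksFrom-positive (suc i) ps)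

sortedPartition : ∀ ds → .(All NonZero ds) → Partition
sortedPartition ds pos = mkPartition (≥-Sort.sort ds) (↭.All-resp-↭ (↭-sym (≥-Sort.sort-↭ ds)) pos) (≥-Sort.sort-↗ ds)

filter-¬-↭ : {P : A → Set} (P? : ∀ x → Dec (P x)) (xs : List A) → filter P? xs ++ filter (¬? ∘ P?) xs ↭ xs
filter-¬-↭ P? []       = ↭-refl
filter-¬-↭ P? (x ∷ xs) with P? x
... | yes _ = ↭.prep x (filter-¬-↭ P? xs)
... | no  _ = ↭-trans (↭.shift x (filter P? xs) _) (↭.prep x (filter-¬-↭ P? xs))

-- Converse of `blocksFrom-injective`: the blocks of multiplicity `i` are sifted out and their
-- degrees sorted. The bound `i + k` guarantees that nothing is left after `k` factors.
∃-blocksFrom : ∀ k i .{{_ : NonZero i}} A → All Positive A →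
  All (λ B → i ≤ Block.multiplicity B × Block.multiplicity B < i + k) A →
  ∃[ ps ] blocksFrom {k} i ps ↭ A
∃-blocksFrom zero    i []      _   _                  = [] , ↭-refl
∃-blocksFrom zero    i (_ ∷ _) _   ((i≤ , <i) ∷ _)    =
  contradiction (ℕ.≤-<-trans i≤ <i) λ i< → ℕ.<⇒≢ i< (sym (ℕ.+-identityʳ i))
∃-blocksFrom (suc k) i A       pos bounds             =
  sortedPartition (map Block.degree A₁) pos₁ ∷ proj₁ rest ,
  ↭-trans (↭.++⁺
    (↭-trans (↭.map⁺ (λ d → mkBlock d i) (≥-Sort.sort-↭ (map Block.degree A₁)))
      (↭-reflexive (map-mkBlock i (All.all-filter (multiplicity? i) A))))
    (proj₂ rest)) (filter-¬-↭ (multiplicity? i) A)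
  where
  A₁ = filter (multiplicity? i) A
  A₂ = filter (¬? ∘ multiplicity? i) A
  pos₁ : All NonZero (map Block.degree A₁)
  pos₁ = All.map⁺ (All.filter⁺ (multiplicity? i) pos)
  rest = ∃-blocksFrom k (suc i) A₂ (All.filter⁺ (¬? ∘ multiplicity? i) pos)
    (All.zipWith (λ {B} (≢ , (i≤ , <i)) → ℕ.≤∧≢⇒< i≤ (λ eq → ≢ (sym eq)) , subst (Block.multiplicity B <_) (ℕ.+-suc i k) <i)
      (All.all-filter (¬? ∘ multiplicity? i) A , All.filter⁺ (¬? ∘ multiplicity? i) bounds))

multiplicity≤wt : ∀ A → All Positive A → All (λ B → Block.multiplicity B ≤ wt A) A
multiplicity≤wt []                     []        = []
multiplicity≤wt (mkBlock d r ∷ A) (pos ∷ poss) =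
  ℕ.≤-trans (ℕ.m≤n*m r d {{pos}}) (ℕ.m≤m+n (d * r) (wt A)) ∷
  All.map (λ le → ℕ.≤-trans le (ℕ.m≤n+m (wt A) (d * r))) (multiplicity≤wt A poss)

multiplicity>0 : ∀ B → 1 ≤ Block.multiplicity B
multiplicity>0 (mkBlock _ zero {{()}})
multiplicity>0 (mkBlock _ (suc r)) = s≤s z≤n

∃-blocks : ∀ {n} A → All Positive A → wt A ≡ n → ∃[ ρ ] blocks {n} ρ ↭ A
∃-blocks {n} A pos refl = mkTyp (proj₁ ps) weight′ , proj₂ ps
  where
  -- Degrees are positive, so each multiplicity is at most the weight `n`, and `n` factors suffice.
  ps = ∃-blocksFrom n 1 A pos
    (All.map (λ {B} le → multiplicity>0 B , s≤s le) (multiplicity≤wt A pos))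
  weight′ : weightedSum 1 (map size (toList (proj₁ ps))) ≡ n
  weight′ = trans (sym (wt-blocksFrom 1 (proj₁ ps))) (sum-↭ (↭.map⁺ blockWeight (proj₂ ps)))

-- Leading monomials

-- Equal to `d² r - d r²`. Splitting a degree `d + e` loses `2 r d e` in the first term and nothing
-- in the second; adding multiplicities `r + s` loses `2 d r s` in the second and nothing in the
-- first. The values lie in ℤ because they are negative for `0 < d < r`.
φ : Block → ℤ
φ (mkBlock d r) = ℤ.+ d ℤ.* ℤ.+ r ℤ.* (ℤ.+ d ℤ.- ℤ.+ r)

Φ : List Block → ℤ
Φ []      = 0ℤ
Φ (B ∷ A) = φ B ℤ.+ Φ A

Φ-++ : ∀ A B → Φ (A ++ B) ≡ Φ A ℤ.+ Φ B
Φ-++ []      B = sym (ℤ.+-identityˡ (Φ B))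
Φ-++ (x ∷ A) B = trans (cong (λ z → φ x ℤ.+ z) (Φ-++ A B)) (sym (ℤ.+-assoc (φ x) (Φ A) (Φ B)))

Φ-↭ : ∀ {A B} → A ↭ B → Φ A ≡ Φ B
Φ-↭ ↭.refl          = refl
Φ-↭ (↭.prep x p)    = cong (λ z → φ x ℤ.+ z) (Φ-↭ p)
Φ-↭ {_ ∷ _ ∷ A} (↭.swap x y p)  = trans (trans (sym (ℤ.+-assoc (φ x) (φ y) (Φ A))) (cong (ℤ._+ Φ A) (ℤ.+-comm (φ x) (φ y))))
  (trans (ℤ.+-assoc (φ y) (φ x) (Φ A)) (cong (λ z → φ y ℤ.+ (φ x ℤ.+ z)) (Φ-↭ p)))
Φ-↭ (↭.trans p q)   = trans (Φ-↭ p) (Φ-↭ q)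

infix 4 _⊑_
-- Equal potential does not determine the multiset of blocks, so the weak case is a permutation
-- instead of `Φ A ≤ Φ B`.
_⊑_ : List Block → List Block → Set
A ⊑ B = Φ A ℤ.< Φ B ⊎ A ↭ B

⊑-reflexive : ∀ {A B} → A ≡ B → A ⊑ B
⊑-reflexive eq = inj₂ (↭-reflexive eq)

⊑-trans : ∀ {A B C} → A ⊑ B → B ⊑ C → A ⊑ C
⊑-trans         (inj₁ p) (inj₁ q) = inj₁ (ℤ.<-trans p q)
⊑-trans {A}     (inj₁ p) (inj₂ q) = inj₁ (subst (Φ A ℤ.<_) (Φ-↭ q) p)
⊑-trans {C = C} (inj₂ p) (inj₁ q) = inj₁ (subst (ℤ._< Φ C) (sym (Φ-↭ p)) q)
⊑-trans         (inj₂ p) (inj₂ q) = inj₂ (↭-trans p q)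

⊑-++ : ∀ {A B C D} → A ⊑ B → C ⊑ D → A ++ C ⊑ B ++ D
⊑-++ {A} {B} {C} {D} (inj₂ p) (inj₂ q) = inj₂ (↭.++⁺ p q)
⊑-++ {A} {B} {C} {D} (inj₁ p) (inj₁ q) = inj₁ (subst₂ ℤ._<_ (sym (Φ-++ A C)) (sym (Φ-++ B D)) (ℤ.+-mono-< p q))
⊑-++ {A} {B} {C} {D} (inj₁ p) (inj₂ q) = inj₁ (subst₂ ℤ._<_ (sym (Φ-++ A C)) (sym (Φ-++ B D)) (ℤ.+-mono-<-≤ p (ℤ.≤-reflexive (Φ-↭ q))))
⊑-++ {A} {B} {C} {D} (inj₂ p) (inj₁ q) = inj₁ (subst₂ ℤ._<_ (sym (Φ-++ A C)) (sym (Φ-++ B D)) (ℤ.+-mono-≤-< (ℤ.≤-reflexive (Φ-↭ p)) q))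

⊑-interchange : ∀ A B C D {A′ B′} → A′ ⊑ A ++ B → B′ ⊑ C ++ D → A′ ++ B′ ⊑ (A ++ C) ++ (B ++ D)
⊑-interchange A B C D p q = ⊑-trans (⊑-++ p q) (inj₂ (↭-trans (↭.++-assoc A B (C ++ D))
  (↭-trans (↭.++⁺ˡ A (↭.shifts B C)) (↭-sym (↭.++-assoc A C (B ++ D))))))

-- Blocks read off a monomial

-- A power of `x_{i,j}` with exponent `e` is read as the block `i^e`, whatever `j` is. Exponent 0
-- gives no block, and below degree 0 gives none either, in keeping with the positivity of parts.
entryBlocks : ℕ → ℕ → List Block
entryBlocks i zero    = []
entryBlocks i (suc e) = [ mkBlock i (suc e) ]

degreeBlocks : (d r : ℕ) .{{_ : NonZero r}} → List Block
degreeBlocks zero    r = []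
degreeBlocks (suc d) r = [ mkBlock (suc d) r ]

<+ : ∀ x {y} → 0ℤ ℤ.< y → x ℤ.< x ℤ.+ y
<+ x {y} 0<y = subst (ℤ._< x ℤ.+ y) (ℤ.+-identityʳ x) (ℤ.+-monoʳ-< x 0<y)

module _ (i : ℕ) where

  -- Multiplying two powers of one variable adds multiplicities, a strict drop of potential unless
  -- one of the exponents is 0.
  entryBlocks-+ : ∀ a b → entryBlocks (suc i) (a + b) ⊑ entryBlocks (suc i) a ++ entryBlocks (suc i) b
  entryBlocks-+ zero    b       = inj₂ ↭-refl
  entryBlocks-+ (suc a) zero    = ⊑-reflexive (cong (entryBlocks (suc i)) (ℕ.+-identityʳ (suc a)))
  entryBlocks-+ (suc a) (suc b) = inj₁ (subst (Φ (entryBlocks (suc i) (suc a + suc b)) ℤ.<_) (sym (identity (ℤ.+ suc i) (ℤ.+ suc a) (ℤ.+ suc b)))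
    -- The gap `2 d x y` is written as a sum of two products of successors, so that its positivity
    -- holds by computation.
    (<+ _ {ℤ.+ suc i ℤ.* ℤ.+ suc a ℤ.* ℤ.+ suc b ℤ.+ ℤ.+ suc i ℤ.* ℤ.+ suc a ℤ.* ℤ.+ suc b} (+<+ (s≤s z≤n))))
    where
    open ℤSolver.+-*-Solver
    identity : ∀ d x y → d ℤ.* x ℤ.* (d ℤ.- x) ℤ.+ (d ℤ.* y ℤ.* (d ℤ.- y) ℤ.+ 0ℤ) ≡
      d ℤ.* (x ℤ.+ y) ℤ.* (d ℤ.- (x ℤ.+ y)) ℤ.+ 0ℤ ℤ.+ (d ℤ.* x ℤ.* y ℤ.+ d ℤ.* x ℤ.* y)
    identity = solve 3 (λ d x y → d :* x :* (d :- x) :+ (d :* y :* (d :- y) :+ con 0ℤ) :=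
      d :* (x :+ y) :* (d :- (x :+ y)) :+ con 0ℤ :+ (d :* x :* y :+ d :* x :* y)) refl

-- Splitting a degree at fixed multiplicity is a strict drop of potential unless one of the two
-- degrees is 0.
degreeBlocks-+ : ∀ r .{{_ : NonZero r}} d e → degreeBlocks d r ++ degreeBlocks e r ⊑ degreeBlocks (d + e) r
degreeBlocks-+ r       zero    e       = inj₂ ↭-refl
degreeBlocks-+ r       (suc d) zero    = ⊑-reflexive (cong (λ d → degreeBlocks d r) (sym (ℕ.+-identityʳ (suc d))))
degreeBlocks-+ (suc r) (suc d) (suc e) = inj₁ (subst (Φ (degreeBlocks (suc d) (suc r) ++ degreeBlocks (suc e) (suc r)) ℤ.<_)
  (sym (identity (ℤ.+ suc r) (ℤ.+ suc d) (ℤ.+ suc e)))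
  (<+ _ {ℤ.+ suc r ℤ.* ℤ.+ suc d ℤ.* ℤ.+ suc e ℤ.+ ℤ.+ suc r ℤ.* ℤ.+ suc d ℤ.* ℤ.+ suc e} (+<+ (s≤s z≤n))))
  where
  open ℤSolver.+-*-Solver
  identity : ∀ r x y → (x ℤ.+ y) ℤ.* r ℤ.* ((x ℤ.+ y) ℤ.- r) ℤ.+ 0ℤ ≡
    x ℤ.* r ℤ.* (x ℤ.- r) ℤ.+ (y ℤ.* r ℤ.* (y ℤ.- r) ℤ.+ 0ℤ) ℤ.+ (r ℤ.* x ℤ.* y ℤ.+ r ℤ.* x ℤ.* y)
  identity = solve 3 (λ r x y → (x :+ y) :* r :* ((x :+ y) :- r) :+ con 0ℤ :=
    x :* r :* (x :- r) :+ (y :* r :* (y :- r) :+ con 0ℤ) :+ (r :* x :* y :+ r :* x :* y)) refl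

rowBlocks : ℕ → List ℕ → List Block
rowBlocks i []       = []
rowBlocks i (e ∷ es) = entryBlocks i e ++ rowBlocks i es

monomialBlocks : ℕ → Monomial → List Block
monomialBlocks i []       = []
monomialBlocks i (es ∷ m) = rowBlocks i es ++ monomialBlocks (suc i) m

rowBlocks-split : ∀ i es {as bs} → (as , bs) ∈ splitList splitℕ es →
  rowBlocks (suc i) es ⊑ rowBlocks (suc i) as ++ rowBlocks (suc i) bs
rowBlocks-split i []       (here refl) = inj₂ ↭-refl
rowBlocks-split i (e ∷ es) p∈ with ∈-cartesianProductWith⁻ _ (splitℕ e) (splitList splitℕ es) p∈
... | (a , b) , (as , bs) , a∈ , as∈ , refl =
  ⊑-interchange (entryBlocks (suc i) a) (entryBlocks (suc i) b) (rowBlocks (suc i) as) (rowBlocks (suc i) bs)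
    (subst (λ e → entryBlocks (suc i) e ⊑ entryBlocks (suc i) a ++ entryBlocks (suc i) b) (splitℕ-sound e a∈) (entryBlocks-+ i a b))
    (rowBlocks-split i es as∈)

monomialBlocks-split : ∀ i m {a b} → (a , b) ∈ factorisations m →
  monomialBlocks (suc i) m ⊑ monomialBlocks (suc i) a ++ monomialBlocks (suc i) b
monomialBlocks-split i []       (here refl) = inj₂ ↭-refl
monomialBlocks-split i (es ∷ m) p∈ with ∈-cartesianProductWith⁻ _ (splitList splitℕ es) (factorisations m) p∈
... | (as , bs) , (a , b) , as∈ , a∈ , refl =
  ⊑-interchange (rowBlocks (suc i) as) (rowBlocks (suc i) bs) (monomialBlocks (2 + i) a) (monomialBlocks (2 + i) b)
    (rowBlocks-split i es as∈) (monomialBlocks-split (suc i) m a∈)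

module _ (r : ℕ) .{{_ : NonZero r}} where

  entryBlocks-zeroOr : ∀ i {e} → ZeroOr r e → ∃[ x ] e ≡ r * x × entryBlocks (suc i) e ⊑ degreeBlocks (suc i * x) r
  entryBlocks-zeroOr i (inj₁ refl) = 0 , sym (ℕ.*-zeroʳ r) ,
    ⊑-reflexive (cong (λ d → degreeBlocks d r) (sym (ℕ.*-zeroʳ i)))
  entryBlocks-zeroOr i (inj₂ refl) = 1 , sym (ℕ.*-identityʳ r) ,
    ⊑-reflexive (trans (lemma r) (cong (λ d → degreeBlocks d r) (sym (ℕ.*-identityʳ (suc i)))))
    where
    lemma : ∀ r .{{_ : NonZero r}} → entryBlocks (suc i) r ≡ degreeBlocks (suc i) r
    lemma (suc r) = refl

  rowBlocks-zeroOr : ∀ i {es} → All (ZeroOr r) es → ∃[ x ] sum es ≡ r * x × rowBlocks (suc i) es ⊑ degreeBlocks (suc i * x) r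
  rowBlocks-zeroOr i []       = 0 , sym (ℕ.*-zeroʳ r) , ⊑-reflexive (cong (λ d → degreeBlocks d r) (sym (ℕ.*-zeroʳ i)))
  rowBlocks-zeroOr i (z ∷ zs) with entryBlocks-zeroOr i z | rowBlocks-zeroOr i zs
  ... | x , eq , p | y , eq′ , q = x + y , trans (cong₂ _+_ eq eq′) (sym (ℕ.*-distribˡ-+ r x y)) ,
    ⊑-trans (⊑-++ p q) (⊑-trans (degreeBlocks-+ r (suc i * x) (suc i * y))
      (⊑-reflexive (cong (λ d → degreeBlocks d r) (sym (ℕ.*-distribˡ-+ (suc i) x y)))))

  -- Every nonzero exponent equals `r`, so all blocks of the monomial have multiplicity `r` and
  -- arise by splitting one degree. The witness `d` adds up their degrees.
  monomialBlocks-zeroOr : ∀ i {m} → All² (ZeroOr r) m →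
    ∃[ d ] weightedSum (suc i) (map sum m) ≡ r * d × monomialBlocks (suc i) m ⊑ degreeBlocks d r
  monomialBlocks-zeroOr i []       = 0 , sym (ℕ.*-zeroʳ r) , inj₂ ↭-refl
  monomialBlocks-zeroOr i (z ∷ zs) with rowBlocks-zeroOr i z | monomialBlocks-zeroOr (suc i) zs
  ... | x , eq , p | d , eq′ , q = suc i * x + d ,
    trans (cong₂ (λ s w → suc i * s + w) eq eq′)
      (solve 4 (λ i r x d → i :* (r :* x) :+ r :* d := r :* (i :* x :+ d)) refl (suc i) r x d) ,
    ⊑-trans (⊑-++ p q) (degreeBlocks-+ r (suc i * x) d)
    where open +-*-Solver

indicator-≢0 : {P : Set} (P? : Dec P) → indicator P? ≢ 0ℚ → P
indicator-≢0 (yes p) _ = p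
indicator-≢0 (no _)  h = contradiction refl h

∑-≢0 : (xs : List I) (f : I → ℚ) → ∑ xs f ≢ 0ℚ → ∃[ x ] x ∈ xs × f x ≢ 0ℚ
∑-≢0 []       f h = contradiction refl h
∑-≢0 (x ∷ xs) f h with f x ℚ.≟ 0ℚ
... | no  fx≢0 = x , here refl , fx≢0
... | yes fx≡0 with ∑-≢0 xs f (λ eq → h (trans (cong₂ ℚ._+_ fx≡0 eq) (ℚ.+-identityˡ 0ℚ)))
...   | y , y∈ , fy≢0 = y , there y∈ , fy≢0

·-≢0 : ∀ f g m → (f · g) m ≢ 0ℚ → ∃[ a ] ∃[ b ] (a , b) ∈ factorisations m × f a ≢ 0ℚ × g b ≢ 0ℚ
·-≢0 f g m h with ∑-≢0 (factorisations m) _ h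
... | (a , b) , ab∈ , fg≢0 = a , b , ab∈ ,
  (λ fa≡0 → fg≢0 (trans (cong (ℚ._* g b) fa≡0) (ℚ.*-zeroˡ (g b)))) ,
  (λ gb≡0 → fg≢0 (trans (cong (f a ℚ.*_) gb≡0) (ℚ.*-zeroʳ (f a))))

monomialBlocks-E⁺ : ∀ B m → Positive B → blockSeries E⁺ B m ≢ 0ℚ → monomialBlocks 1 m ⊑ [ B ]
monomialBlocks-E⁺ (mkBlock (suc d) r) m _ h
  with indicator-≢0 (all? (all? (zeroOr? r)) m ×-dec (deg m ≟ r * suc d)) (λ eq → h (trans (substPower-E r (suc d) m) eq))
... | zs , deg≡ with monomialBlocks-zeroOr r 0 zs
...   | d′ , eq , p with ℕ.*-cancelˡ-≡ d′ (suc d) r (trans (sym eq) deg≡)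
...     | refl = p

monomialBlocks-0 : ∀ i {m} → All² (_≡ 0) m → monomialBlocks i m ≡ []
monomialBlocks-0 i []       = refl
monomialBlocks-0 i (z ∷ zs) = cong₂ _++_ (row z) (monomialBlocks-0 (suc i) zs)
  where
  row : ∀ {es} → All (_≡ 0) es → rowBlocks i es ≡ []
  row []         = refl
  row (refl ∷ z) = row z

-- A nonzero coefficient yields a factorisation with both coefficients nonzero. The first factor
-- splits the degree of `B`, and multiplying the factors adds multiplicities wherever they share a
-- variable.
monomialBlocks-E-product : ∀ A m → All Positive A → E-product A m ≢ 0ℚ → monomialBlocks 1 m ⊑ A
monomialBlocks-E-product []      m _          h =
  ⊑-reflexive (monomialBlocks-0 1 (indicator-≢0 (all? (all? (_≟ 0)) m) h))
monomialBlocks-E-product (B ∷ A) m (pos ∷ poss) h with ·-≢0 (blockSeries E⁺ B) (E-product A) m h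
... | a , b , ab∈ , ha , hb = ⊑-trans (monomialBlocks-split 0 m ab∈)
  (⊑-++ (monomialBlocks-E⁺ B a pos ha) (monomialBlocks-E-product A b poss hb))

-- Positivity of the diagonal coefficients

indicator-≥0 : {P : Set} (P? : Dec P) → 0ℚ ℚ.≤ indicator P?
indicator-≥0 (yes _) = ℚ.nonNegative⁻¹ 1ℚ
indicator-≥0 (no _)  = ℚ.≤-refl

*-≥0 : ∀ {p q} → 0ℚ ℚ.≤ p → 0ℚ ℚ.≤ q → 0ℚ ℚ.≤ p ℚ.* q
*-≥0 {p} {q} p≥0 q≥0 = subst (ℚ._≤ p ℚ.* q) (ℚ.*-zeroʳ p) (ℚ.*-monoˡ-≤-nonNeg p {{ℚ.nonNegative p≥0}} q≥0)

*->0 : ∀ {p q} → 0ℚ ℚ.< p → 0ℚ ℚ.< q → 0ℚ ℚ.< p ℚ.* q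
*->0 {p} {q} p>0 q>0 = subst (ℚ._< p ℚ.* q) (ℚ.*-zeroʳ p) (ℚ.*-monoʳ-<-pos p {{ℚ.positive p>0}} q>0)

∑-≥0 : (xs : List I) (f : I → ℚ) → (∀ x → 0ℚ ℚ.≤ f x) → 0ℚ ℚ.≤ ∑ xs f
∑-≥0 []       f h = ℚ.≤-refl
∑-≥0 (x ∷ xs) f h = ℚ.+-mono-≤ (h x) (∑-≥0 xs f h)

∑->0 : {xs : List I} {x : I} (f : I → ℚ) → (∀ x → 0ℚ ℚ.≤ f x) → x ∈ xs → 0ℚ ℚ.< f x → 0ℚ ℚ.< ∑ xs f
∑->0 {xs = _ ∷ xs} f h (here refl) fx>0 = ℚ.+-mono-<-≤ fx>0 (∑-≥0 xs f h)
∑->0 {xs = y ∷ _}  f h (there x∈)  fx>0 = ℚ.+-mono-≤-< (h y) (∑->0 f h x∈ fx>0)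

blockSeries-≥0 : ∀ B m → 0ℚ ℚ.≤ blockSeries E⁺ B m
blockSeries-≥0 (mkBlock d r) m = subst (0ℚ ℚ.≤_) (sym (substPower-E r d m))
  (indicator-≥0 (all? (all? (zeroOr? r)) m ×-dec (deg m ≟ r * d)))

E-product-≥0 : ∀ A m → 0ℚ ℚ.≤ E-product A m
E-product-≥0 []      m = indicator-≥0 (all? (all? (_≟ 0)) m)
E-product-≥0 (B ∷ A) m = ∑-≥0 (factorisations m) _ λ (a , b) → *-≥0 (blockSeries-≥0 B a) (E-product-≥0 A b)

-- Renames `x_{i,j}` to `x_{i,j+1}`, which frees the first column for a new block.
pad : Monomial → Monomial
pad = map (0 ∷_)

conv-pad : ∀ m (F : Monomial → Monomial → ℚ) →
  conv factorisations (pad m) F ≡ conv factorisations m λ a b → F (pad a) (pad b)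
conv-pad []       F = refl
conv-pad (es ∷ m) F = trans (conv-∷ (splitList splitℕ) (0 ∷ es) (pad m) F)
  (trans (trans (conv-∷ splitℕ 0 es _) (ℚ.+-identityʳ _))
  (trans (conv-cong (splitList splitℕ) es λ as bs → conv-pad m λ a b → F ((0 ∷ as) ∷ a) ((0 ∷ bs) ∷ b))
  (sym (conv-∷ (splitList splitℕ) es m _))))

All²-pad : {P : ℕ → Set} → P 0 → ∀ {m} → All² P m → All² P (pad m)
All²-pad p0 = All.map⁺ ∘ All.map (p0 ∷_)

All²-pad⁻ : {P : ℕ → Set} → ∀ {m} → All² P (pad m) → All² P m
All²-pad⁻ = All.map All.tail ∘ All.map⁻

deg-pad : ∀ m → deg (pad m) ≡ deg m
deg-pad m = cong (weightedSum 1) (sym (map-∘ m))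

blockSeries-pad : ∀ B m → blockSeries E⁺ B (pad m) ≡ blockSeries E⁺ B m
blockSeries-pad (mkBlock d r) m = trans (substPower-E r d (pad m)) (trans
  (indicator-cong (all? (all? (zeroOr? r)) (pad m) ×-dec (deg (pad m) ≟ r * d)) (all? (all? (zeroOr? r)) m ×-dec (deg m ≟ r * d))
    (λ (zs , eq) → All²-pad⁻ zs , trans (sym (deg-pad m)) eq)
    (λ (zs , eq) → All²-pad (inj₁ refl) zs , trans (deg-pad m) eq))
  (sym (substPower-E r d m)))

E-product-pad : ∀ A m → E-product A (pad m) ≡ E-product A m
E-product-pad []      m = indicator-cong (all? (all? (_≟ 0)) (pad m)) (all? (all? (_≟ 0)) m) All²-pad⁻ (All²-pad refl)
E-product-pad (B ∷ A) m = trans (conv-pad m λ a b → blockSeries E⁺ B a ℚ.* E-product A b)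
  (∑-cong (factorisations m) λ (a , b) → cong₂ ℚ._*_ (blockSeries-pad B a) (E-product-pad A b))

entry : ℕ → Block → ℕ
entry i (mkBlock d r) with d ≟ i
... | yes _ = r
... | no  _ = 0

-- The j-th block d^r of A contributes the factor x_{d,j}^r; the rows
-- i, …, i + k − 1 are listed.
monomial : ℕ → ℕ → List Block → Monomial
monomial zero    i A = []
monomial (suc k) i A = map (entry i) A ∷ monomial k (suc i) A

-- For `B = d^r` with `d` among the listed rows, this is `x_{d,1}^r`. The zeros give it the shape of
-- the monomial of `B ∷ A`, since a factorisation keeps the lengths of all rows.
variable-power : ℕ → ℕ → Block → List Block → Monomial
variable-power zero    i B A = []
variable-power (suc k) i B A = (entry i B ∷ map (λ _ → 0) A) ∷ variable-power k (suc i) B A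

monomial-∷ : ∀ k i B A → (variable-power k i B A , pad (monomial k i A)) ∈ factorisations (monomial k i (B ∷ A))
monomial-∷ zero    i B A = here refl
monomial-∷ (suc k) i B A = ∈-cartesianProductWith⁺ _
  (∈-cartesianProductWith⁺ _ (subst (λ e → (entry i B , 0) ∈ splitℕ e) (ℕ.+-identityʳ _) (splitℕ-complete (entry i B) 0)) (zeros A))
  (monomial-∷ k (suc i) B A)
  where
  zeros : ∀ A → (map (λ _ → 0) A , map (entry i) A) ∈ splitList splitℕ (map (entry i) A)
  zeros []      = here refl
  zeros (B ∷ A) = ∈-cartesianProductWith⁺ _ (splitℕ-complete 0 (entry i B)) (zeros A)

entry-≡ : ∀ d r .{{_ : NonZero r}} → entry d (mkBlock d r) ≡ r
entry-≡ d r with d ≟ d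
... | yes _  = refl
... | no d≢d = contradiction refl d≢d

entry-≢ : ∀ {i d} r .{{_ : NonZero r}} → d ≢ i → entry i (mkBlock d r) ≡ 0
entry-≢ {i} {d} r d≢i with d ≟ i
... | yes d≡i = contradiction d≡i d≢i
... | no  _   = refl

variable-power-zeroOr : ∀ k i d r .{{_ : NonZero r}} A → All² (ZeroOr r) (variable-power k i (mkBlock d r) A)
variable-power-zeroOr zero    i d r A = []
variable-power-zeroOr (suc k) i d r A =
  (zeroOr-entry ∷ All.map⁺ (All.universal (λ _ → inj₁ refl) A)) ∷ variable-power-zeroOr k (suc i) d r A
  where
  zeroOr-entry : ZeroOr r (entry i (mkBlock d r))
  zeroOr-entry with d ≟ i
  ... | yes _ = inj₂ refl
  ... | no  _ = inj₁ refl

sum-unit : ∀ e (A : List Block) → sum (e ∷ map (λ _ → 0) A) ≡ e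
sum-unit e []      = ℕ.+-identityʳ e
sum-unit e (_ ∷ A) = sum-unit e A

module _ (d r : ℕ) .{{_ : NonZero r}} (A : List Block) where

  private
    row : ∀ i w → i * sum (entry i (mkBlock d r) ∷ map (λ _ → 0) A) + w ≡ i * entry i (mkBlock d r) + w
    row i w = cong (λ s → i * s + w) (sum-unit (entry i (mkBlock d r)) A)

  weightedSum-below : ∀ k i → d < i → weightedSum i (map sum (variable-power k i (mkBlock d r) A)) ≡ 0
  weightedSum-below zero    i d<i = refl
  weightedSum-below (suc k) i d<i = trans (row i _) (cong₂ _+_
    (trans (cong (i *_) (entry-≢ r (ℕ.<⇒≢ d<i))) (ℕ.*-zeroʳ i))
    (weightedSum-below k (suc i) (ℕ.m<n⇒m<1+n d<i)))

  weightedSum-variable-power : ∀ k i → i ≤ d → d < i + k →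
    weightedSum i (map sum (variable-power k i (mkBlock d r) A)) ≡ r * d
  weightedSum-variable-power zero    i i≤d d<i = contradiction (ℕ.≤-<-trans i≤d d<i) λ i< → ℕ.<⇒≢ i< (sym (ℕ.+-identityʳ i))
  weightedSum-variable-power (suc k) i i≤d d<i+k = trans (row i _) (step (d ≟ i))
    where
    step : Dec (d ≡ i) → i * entry i (mkBlock d r) + weightedSum (suc i) (map sum (variable-power k (suc i) (mkBlock d r) A)) ≡ r * d
    step (yes refl) = trans (cong₂ _+_
      (trans (cong (i *_) (entry-≡ i r)) (ℕ.*-comm i r)) (weightedSum-below k (suc i) ℕ.≤-refl)) (ℕ.+-identityʳ (r * i))
    step (no d≢i)   = cong₂ _+_ (trans (cong (i *_) (entry-≢ r d≢i)) (ℕ.*-zeroʳ i))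
      (weightedSum-variable-power k (suc i) (ℕ.≤∧≢⇒< i≤d (≢-sym d≢i)) (subst (d <_) (ℕ.+-suc i k) d<i+k))

  monomialBlocks-below : ∀ k i → d < i → monomialBlocks i (monomial k i (mkBlock d r ∷ A)) ≡ monomialBlocks i (monomial k i A)
  monomialBlocks-below zero    i d<i = refl
  monomialBlocks-below (suc k) i d<i = cong₂ (λ e rest → (entryBlocks i e ++ rowBlocks i (map (entry i) A)) ++ rest)
    (entry-≢ r (ℕ.<⇒≢ d<i)) (monomialBlocks-below k (suc i) (ℕ.m<n⇒m<1+n d<i))

  monomialBlocks-∷ : ∀ k i → i ≤ d → d < i + k →
    monomialBlocks i (monomial k i (mkBlock d r ∷ A)) ↭ mkBlock d r ∷ monomialBlocks i (monomial k i A)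
  monomialBlocks-∷ zero    i i≤d d<i = contradiction (ℕ.≤-<-trans i≤d d<i) λ i< → ℕ.<⇒≢ i< (sym (ℕ.+-identityʳ i))
  monomialBlocks-∷ (suc k) i i≤d d<i+k with d ≟ i
  ... | yes refl = ↭-reflexive (cong₂ (λ e rest → (e ++ rowBlocks i (map (entry i) A)) ++ rest)
          (entryBlocks-≢0 r) (monomialBlocks-below k (suc i) ℕ.≤-refl))
    where
    entryBlocks-≢0 : ∀ r .{{_ : NonZero r}} → entryBlocks i r ≡ [ mkBlock i r ]
    entryBlocks-≢0 (suc r) = refl
  ... | no  d≢i  = ↭-trans
    (↭.++⁺ˡ (rowBlocks i (map (entry i) A)) (monomialBlocks-∷ k (suc i) (ℕ.≤∧≢⇒< i≤d (≢-sym d≢i)) (subst (d <_) (ℕ.+-suc i k) d<i+k)))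
    (↭.shift (mkBlock d r) (rowBlocks i (map (entry i) A)) _)

monomialBlocks-[] : ∀ k i → monomialBlocks i (monomial k i []) ≡ []
monomialBlocks-[] zero    i = refl
monomialBlocks-[] (suc k) i = monomialBlocks-[] k (suc i)

InRange : ℕ → Block → Set
InRange k B = 1 ≤ Block.degree B × Block.degree B ≤ k

monomialBlocks-monomial : ∀ k A → All (InRange k) A → monomialBlocks 1 (monomial k 1 A) ↭ A
monomialBlocks-monomial k []                []                 = ↭-reflexive (monomialBlocks-[] k 1)
monomialBlocks-monomial k (mkBlock d r ∷ A) ((1≤d , d≤k) ∷ bs) =
  ↭-trans (monomialBlocks-∷ d r A k 1 1≤d (s≤s d≤k)) (↭.prep _ (monomialBlocks-monomial k A bs))

monomial-[] : ∀ k i → All² (_≡ 0) (monomial k i [])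
monomial-[] zero    i = []
monomial-[] (suc k) i = [] ∷ monomial-[] k (suc i)

-- The factorisation that separates the first column contributes 1 times a coefficient that is
-- positive by induction; all other terms are nonnegative.
E-product-monomial : ∀ k A → All (InRange k) A → 0ℚ ℚ.< E-product A (monomial k 1 A)
E-product-monomial k []                []                 =
  subst (0ℚ ℚ.<_) (sym (indicator-true (all? (all? (_≟ 0)) (monomial k 1 [])) (monomial-[] k 1))) (ℚ.positive⁻¹ 1ℚ)
E-product-monomial k (mkBlock d r ∷ A) ((1≤d , d≤k) ∷ bs) =
  ∑->0 _ (λ (a , b) → *-≥0 (blockSeries-≥0 (mkBlock d r) a) (E-product-≥0 A b)) (monomial-∷ k 1 (mkBlock d r) A)
    (*->0 (subst (0ℚ ℚ.<_) (sym coefficient-1) (ℚ.positive⁻¹ 1ℚ))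
      (subst (0ℚ ℚ.<_) (sym (E-product-pad A (monomial k 1 A))) (E-product-monomial k A bs)))
  where
  v = variable-power k 1 (mkBlock d r) A
  coefficient-1 : substPower r (E⁺ d) v ≡ 1ℚ
  coefficient-1 = trans (substPower-E r d v) (indicator-true (all? (all? (zeroOr? r)) v ×-dec (deg v ≟ r * d))
    (variable-power-zeroOr k 1 d r A , weightedSum-variable-power d r A k 1 1≤d (s≤s d≤k)))

-- Linear independence and the expansion

module _ (_≟ᴵ_ : DecidableEquality I) where

  -- The collected coefficient of `i` in a formal combination with repeated indices. Combinations
  -- can then be added by concatenating lists, whatever their supports are.
  total : List (ℚ × I) → I → ℚ
  total L i = ∑ L λ (q , j) → q ℚ.* indicator (i ≟ᴵ j)

  ∑-delta : ∀ {U} → Unique U → ∀ {j} → j ∈ U → (g : I → ℚ) → (∑ U λ i → indicator (i ≟ᴵ j) ℚ.* g i) ≡ g j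
  ∑-delta U! {j} j∈ g = trans
    (∑-single _ U! j∈ λ i _ j≢i → trans (cong (ℚ._* g i) (indicator-¬ (i ≟ᴵ j) (j≢i ∘ sym))) (ℚ.*-zeroˡ (g i)))
    (trans (cong (ℚ._* g j) (indicator-true (j ≟ᴵ j) refl)) (ℚ.*-identityˡ (g j)))

  ∑-collect : ∀ L {U} → Unique U → (∀ {p} → p ∈ L → proj₂ p ∈ U) → (g : I → ℚ) →
    (∑ L λ (q , j) → q ℚ.* g j) ≡ ∑ U λ i → total L i ℚ.* g i
  ∑-collect L {U} U! L⊆U g = sym (begin
    (∑ U λ i → total L i ℚ.* g i)
      ≡⟨ ∑-cong U (λ i → trans (sym (∑-*ʳ (g i) L _)) (∑-cong L λ (q , j) → ℚ.*-assoc q _ (g i))) ⟩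
    (∑ U λ i → ∑ L λ (q , j) → q ℚ.* (indicator (i ≟ᴵ j) ℚ.* g i))
      ≡⟨ ∑-swap U L _ ⟩
    (∑ L λ (q , j) → ∑ U λ i → q ℚ.* (indicator (i ≟ᴵ j) ℚ.* g i))
      ≡⟨ ∑-cong-∈ L (λ (q , j) p∈ → trans (∑-*ˡ q U _) (cong (q ℚ.*_) (∑-delta U! (L⊆U p∈) g))) ⟩
    (∑ L λ (q , j) → q ℚ.* g j) ∎)

  total-∉ : ∀ L {i} → (∀ {p} → p ∈ L → proj₂ p ≢ i) → total L i ≡ 0ℚ
  total-∉ L {i} h = ∑-zero L λ (q , j) p∈ → trans (cong (q ℚ.*_) (indicator-¬ (i ≟ᴵ j) (h p∈ ∘ sym))) (ℚ.*-zeroʳ q)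

  total-++ : ∀ L L′ i → total (L ++ L′) i ≡ total L i ℚ.+ total L′ i
  total-++ L L′ i = ∑-++ L L′ _

  total-unique : ∀ {S} → Unique S → (c : I → ℚ) → (∀ i → i ∉ S → c i ≡ 0ℚ) → ∀ i →
    total (map (λ j → c j , j) S) i ≡ c i
  total-unique {S} S! c vanishes i = trans (∑-map _ S _) (go (i ∈? S))
    where
    open import Data.List.Membership.DecPropositional _≟ᴵ_ using (_∈?_)
    go : Dec (i ∈ S) → (∑ S λ j → c j ℚ.* indicator (i ≟ᴵ j)) ≡ c i
    go (yes i∈) = trans (∑-single _ S! i∈ λ j _ i≢j → trans (cong (c j ℚ.*_) (indicator-¬ (i ≟ᴵ j) i≢j)) (ℚ.*-zeroʳ (c j)))
      (trans (cong (c i ℚ.*_) (indicator-true (i ≟ᴵ i) refl)) (ℚ.*-identityʳ (c i)))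
    go (no i∉) = trans (∑-zero S λ j j∈ → trans (cong (c j ℚ.*_) (indicator-¬ (i ≟ᴵ j) λ { refl → i∉ j∈ })) (ℚ.*-zeroʳ (c j)))
      (sym (vanishes i i∉))

∑-neg : {A : Set} (xs : List A) (f : A → ℚ) → ∑ xs (λ x → ℚ.- f x) ≡ ℚ.- ∑ xs f
∑-neg []       f = refl
∑-neg (x ∷ xs) f = trans (cong (ℚ.- f x ℚ.+_) (∑-neg xs f)) (sym (ℚ.neg-distrib-+ (f x) (∑ xs f)))

-- `fromℕ N` is normalised through a gcd that does not compute for a variable `N`; passing to the
-- explicit normal form `mkℚ` lets the addition reduce.
fromℕ-suc : ∀ N → fromℕ (suc N) ≡ 1ℚ ℚ.+ fromℕ N
fromℕ-suc N = begin
  fromℕ (suc N)                                                         ≡⟨ cong₂ (λ a b → (a ℤ.+ b) ℚ./ 1) (sym (ℤ.*-identityʳ (ℤ.+ 1))) (sym (ℤ.*-identityʳ (ℤ.+ N))) ⟩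
  (ℤ.+ 1 ℤ.* ℤ.+ 1 ℤ.+ ℤ.+ N ℤ.* ℤ.+ 1) ℚ./ 1                             ≡⟨⟩
  1ℚ ℚ.+ ℚ.mkℚ (ℤ.+ N) 0 (Coprimality.sym (Coprimality.1-coprimeTo N))    ≡⟨ cong (1ℚ ℚ.+_) (ℚ.normalize-coprime (Coprimality.sym (Coprimality.1-coprimeTo N))) ⟨
  1ℚ ℚ.+ fromℕ N                                                          ∎

∑-count : {A : Set} {P : A → Set} (P? : ∀ x → Dec (P x)) (xs : List A) →
  (∑ xs λ x → indicator (P? x)) ≡ fromℕ (length (filter P? xs))
∑-count P? []       = refl
∑-count P? (x ∷ xs) with P? x
... | yes _ = trans (cong (1ℚ ℚ.+_) (∑-count P? xs)) (sym (fromℕ-suc (length (filter P? xs))))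
... | no  _ = trans (ℚ.+-identityˡ _) (∑-count P? xs)

module _ {n : ℕ} where

  blocks-positive : (σ : Typ n) → All Positive (blocks σ)
  blocks-positive σ = blocksFrom-positive 1 (factors σ)

  degree≤wt : ∀ A → All (λ B → Block.degree B ≤ wt A) A
  degree≤wt []                = []
  degree≤wt (mkBlock d r ∷ A) =
    ℕ.≤-trans (ℕ.m≤m*n d r) (ℕ.m≤m+n (d * r) (wt A)) ∷
    All.map (λ le → ℕ.≤-trans le (ℕ.m≤n+m (wt A) (d * r))) (degree≤wt A)

  blocks-inRange : (σ : Typ n) → All (InRange n) (blocks σ)
  blocks-inRange σ = All.zipWith (λ (pos , le) → ℕ.>-nonZero⁻¹ _ {{pos}} , subst (_ ≤_) (wt-blocks σ) le)
    (blocks-positive σ , degree≤wt (blocks σ))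

  leadingMonomial : Typ n → Monomial
  leadingMonomial σ = monomial n 1 (blocks σ)

  rank : Typ n → ℤ.ℤ
  rank σ = Φ (blocks σ)

  leading-≢0 : ∀ σ → typeSeries E⁺ σ (leadingMonomial σ) ≢ 0ℚ
  leading-≢0 σ eq = ℚ.<⇒≢ (E-product-monomial n (blocks σ) (blocks-inRange σ)) (sym eq)

  -- The leading monomial of `σ` reads back as the blocks of `σ`, so the comparison with the blocks
  -- of `ρ` is one between types.
  leading-triangular : ∀ σ ρ → typeSeries E⁺ ρ (leadingMonomial σ) ≢ 0ℚ → rank σ ℤ.< rank ρ ⊎ σ ≡ ρ
  leading-triangular σ ρ h
    with ⊑-trans (inj₂ (↭-sym (monomialBlocks-monomial n (blocks σ) (blocks-inRange σ))))
           (monomialBlocks-E-product (blocks ρ) (leadingMonomial σ) (blocks-positive ρ) h)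
  ... | inj₁ lt = inj₁ lt
  ... | inj₂ p  = inj₂ (blocks-injective p)

  -- Among the types with nonzero total coefficient, take one of maximal rank:
  -- only it contributes to the coefficient of its leading monomial.
  independent : (L : List (ℚ × Typ n)) → (∀ m → (∑ L λ (q , ρ) → q ℚ.* typeSeries E⁺ ρ m) ≡ 0ℚ) → ∀ σ → total _≟ᵀ_ L σ ≡ 0ℚ
  independent L h σ = decidable-stable (total _≟ᵀ_ L σ ℚ.≟ 0ℚ) contra
    where
    open import Data.List.Membership.DecPropositional (_≟ᵀ_ {n}) using (_∈?_)
    T = total _≟ᵀ_ L
    U = deduplicate _≟ᵀ_ (map proj₂ L)
    U! : Unique U
    U! = DecUnique.deduplicate-! _≟ᵀ_ (map proj₂ L)
    L⊆U : ∀ {p} → p ∈ L → proj₂ p ∈ U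
    L⊆U p∈ = ∈-deduplicate⁺ _≟ᵀ_ (∈-map⁺ proj₂ p∈)
    ∈U : ∀ {ρ} → T ρ ≢ 0ℚ → ρ ∈ U
    ∈U {ρ} T≢0 = decidable-stable (ρ ∈? U) λ ρ∉ → T≢0 (total-∉ _≟ᵀ_ L λ { p∈ refl → ρ∉ (L⊆U p∈) })
    nonzero? : ∀ ρ → Dec (T ρ ≢ 0ℚ)
    nonzero? ρ = ¬? (T ρ ℚ.≟ 0ℚ)
    Z = filter nonzero? U

    contra : ¬ (T σ ≢ 0ℚ)
    contra T≢0 = leading-≢0 σ* (begin
      g σ*                        ≡⟨ ℚ.*-identityˡ (g σ*) ⟨
      1ℚ ℚ.* g σ*                   ≡⟨ cong (ℚ._* g σ*) (ℚ.*-inverseˡ (T σ*) {{nz}}) ⟨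
      (ℚ.1/ T σ*) {{nz}} ℚ.* T σ* ℚ.* g σ*   ≡⟨ ℚ.*-assoc ((ℚ.1/ T σ*) {{nz}}) (T σ*) (g σ*) ⟩
      (ℚ.1/ T σ*) {{nz}} ℚ.* (T σ* ℚ.* g σ*) ≡⟨ cong ((ℚ.1/ T σ*) {{nz}} ℚ.*_) Tg≡0 ⟩
      (ℚ.1/ T σ*) {{nz}} ℚ.* 0ℚ            ≡⟨ ℚ.*-zeroʳ ((ℚ.1/ T σ*) {{nz}}) ⟩
      0ℚ ∎)
      where
      -- The default `σ` also has a nonzero coefficient, so the maximiser has one wherever it comes
      -- from.
      σ* = argmax rank σ Z
      g : Typ n → ℚ
      g ρ = typeSeries E⁺ ρ (leadingMonomial σ*)
      T*≢0 : T σ* ≢ 0ℚ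
      T*≢0 = argmax-all rank T≢0 (All.tabulate λ ρ∈ → proj₂ (∈-filter⁻ nonzero? {xs = U} ρ∈))
      nz : ℚ.NonZero (T σ*)
      nz = ℚ.≢-nonZero T*≢0
      others : ∀ ρ → ρ ∈ U → σ* ≢ ρ → T ρ ℚ.* g ρ ≡ 0ℚ
      others ρ ρ∈ σ*≢ρ with T ρ ℚ.≟ 0ℚ | g ρ ℚ.≟ 0ℚ
      ... | yes Tρ≡0 | _ = trans (cong (ℚ._* g ρ) Tρ≡0) (ℚ.*-zeroˡ (g ρ))
      ... | no _     | yes gρ≡0 = trans (cong (T ρ ℚ.*_) gρ≡0) (ℚ.*-zeroʳ (T ρ))
      ... | no Tρ≢0  | no gρ≢0 with leading-triangular σ* ρ gρ≢0
      ...   | inj₂ σ*≡ρ = contradiction σ*≡ρ σ*≢ρ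
      ...   | inj₁ lt   = contradiction lt (ℤ.≤⇒≯ (All.lookup (f[xs]≤f[argmax] {f = rank} σ Z) (∈-filter⁺ nonzero? ρ∈ Tρ≢0)))
      Tg≡0 : T σ* ℚ.* g σ* ≡ 0ℚ
      Tg≡0 = begin
        T σ* ℚ.* g σ*                ≡⟨ ∑-single (λ ρ → T ρ ℚ.* g ρ) U! (∈U T*≢0) others ⟨
        (∑ U λ ρ → T ρ ℚ.* g ρ)      ≡⟨ ∑-collect _≟ᵀ_ L U! L⊆U g ⟨
        (∑ L λ (q , ρ) → q ℚ.* g ρ)  ≡⟨ h (leadingMonomial σ*) ⟩
        0ℚ ∎

  -- The two supports may differ, so the difference is formed as the concatenation of one expansion
  -- with the negated other, and independence is applied to that list.
  coefficients-unique : ∀ {f : Series} (e e′ : Expansion (typeSeries E⁺ {n}) f) → coeff e ≗ coeff e′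
  coefficients-unique {f} e e′ σ = begin
    coeff e σ                                  ≡⟨ ℚ.+-identityʳ (coeff e σ) ⟨
    coeff e σ ℚ.+ 0ℚ                             ≡⟨ cong (coeff e σ ℚ.+_) (ℚ.+-inverseˡ (coeff e′ σ)) ⟨
    coeff e σ ℚ.+ (ℚ.- coeff e′ σ ℚ.+ coeff e′ σ)    ≡⟨ ℚ.+-assoc (coeff e σ) _ _ ⟨
    (coeff e σ ℚ.+ ℚ.- coeff e′ σ) ℚ.+ coeff e′ σ    ≡⟨ cong (ℚ._+ coeff e′ σ) difference ⟩
    0ℚ ℚ.+ coeff e′ σ                            ≡⟨ ℚ.+-identityˡ (coeff e′ σ) ⟩
    coeff e′ σ                                 ∎
    where
    module e = Expansion e
    module e′ = Expansion e′
    c′ : Typ n → ℚ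
    c′ ρ = ℚ.- e′.coeff ρ
    L₁ = map (λ ρ → e.coeff ρ , ρ) e.support
    L₂ = map (λ ρ → c′ ρ , ρ) e′.support

    cancels : ∀ m → (∑ (L₁ ++ L₂) λ (q , ρ) → q ℚ.* typeSeries E⁺ ρ m) ≡ 0ℚ
    cancels m = begin
      (∑ (L₁ ++ L₂) λ (q , ρ) → q ℚ.* typeSeries E⁺ ρ m)
        ≡⟨ trans (∑-++ L₁ L₂ _) (cong₂ ℚ._+_ (∑-map _ e.support _) (∑-map _ e′.support _)) ⟩
      (∑ e.support λ ρ → e.coeff ρ ℚ.* typeSeries E⁺ ρ m) ℚ.+ (∑ e′.support λ ρ → c′ ρ ℚ.* typeSeries E⁺ ρ m)
        ≡⟨ cong₂ ℚ._+_ (sym (e.expands m)) (trans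
             (trans (∑-cong e′.support λ ρ → sym (ℚ.neg-distribˡ-* (e′.coeff ρ) (typeSeries E⁺ ρ m))) (∑-neg e′.support _))
             (cong (ℚ.-_) (sym (e′.expands m)))) ⟩
      f m ℚ.+ ℚ.- f m
        ≡⟨ ℚ.+-inverseʳ (f m) ⟩
      0ℚ ∎

    difference : coeff e σ ℚ.+ ℚ.- coeff e′ σ ≡ 0ℚ
    difference = begin
      coeff e σ ℚ.+ c′ σ
        ≡⟨ cong₂ ℚ._+_ (total-unique _≟ᵀ_ e.unique e.coeff e.vanishes σ)
             (total-unique _≟ᵀ_ e′.unique c′ (λ ρ ρ∉ → cong (ℚ.-_) (e′.vanishes ρ ρ∉)) σ) ⟨
      total _≟ᵀ_ L₁ σ ℚ.+ total _≟ᵀ_ L₂ σ ≡⟨ total-++ _≟ᵀ_ L₁ L₂ σ ⟨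
      total _≟ᵀ_ (L₁ ++ L₂) σ ≡⟨ independent (L₁ ++ L₂) cancels σ ⟩
      0ℚ ∎

  -- Expansion of `H_σ` and the count of tabloids

  module _ (σ : Typ n) where

    code⇒type : ∀ {c} → c ∈ codes (blocks σ) → ∃[ ρ ] blocks ρ ↭ codeContent (blocks σ) c
    code⇒type {c} c∈ = ∃-blocks (codeContent (blocks σ) c) (codeContent-positive (blocks σ) c)
      (trans (wt-codeContent (blocks σ) c∈) (wt-blocks σ))

    hasContent? : ∀ (τ : Typ n) c → Dec (codeContent (blocks σ) c ↭ blocks τ)
    hasContent? τ c = codeContent (blocks σ) c ↭ᴮ? blocks τ

    codesOf : Typ n → List (List (List Brick))
    codesOf τ = filter (hasContent? τ) (codes (blocks σ))

    typedCodes : ∀ cs → All (λ c → ∃[ ρ ] blocks ρ ↭ codeContent (blocks σ) c) cs → List (ℚ × Typ n)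
    typedCodes cs = reduce (λ (ρ , _) → 1ℚ , ρ)

    typedCodes-∑ : ∀ {cs} ps m → (∑ cs λ c → E-product (codeContent (blocks σ) c) m) ≡
      ∑ (typedCodes cs ps) λ (q , ρ) → q ℚ.* typeSeries E⁺ ρ m
    typedCodes-∑ []             m = refl
    typedCodes-∑ ((ρ , p) ∷ ps) m = cong₂ ℚ._+_
      (trans (sym (E-product-↭ p m)) (sym (ℚ.*-identityˡ (typeSeries E⁺ ρ m)))) (typedCodes-∑ ps m)

    -- Each code enters with coefficient 1 at the type of its content, so collecting at `τ` counts
    -- the codes of content `τ`.
    total-typedCodes : ∀ {cs} ps τ → total _≟ᵀ_ (typedCodes cs ps) τ ≡ fromℕ (length (filter (hasContent? τ) cs))
    total-typedCodes {cs} ps τ = trans (go ps) (∑-count (hasContent? τ) cs)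
      where
      go : ∀ {cs} ps → total _≟ᵀ_ (typedCodes cs ps) τ ≡ ∑ cs λ c → indicator (hasContent? τ c)
      go []                       = refl
      go {c ∷ _} ((ρ , p) ∷ ps) = cong₂ ℚ._+_ (trans (ℚ.*-identityˡ _)
        (indicator-cong (τ ≟ᵀ ρ) (hasContent? τ c) (λ { refl → ↭-sym p })
          (λ q → blocks-injective (↭-sym (↭-trans p q))))) (go ps)

    -- The support is the set of types that occur as contents of codes. Off it the count is 0,
    -- because no code has that content.
    H-expansion : Expansion (typeSeries E⁺ {n}) (typeSeries H σ)
    H-expansion = record
      { coeff    = λ τ → fromℕ (length (codesOf τ))
      ; support  = U
      ; unique   = U!
      ; vanishes = λ τ τ∉ → trans (sym (total-typedCodes ps τ)) (total-∉ _≟ᵀ_ L λ { p∈ refl → τ∉ (L⊆U p∈) })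
      ; expands  = λ m → begin
          typeSeries H σ m                                                       ≡⟨ H-codes (blocks σ) m ⟩
          (∑ (codes (blocks σ)) λ c → E-product (codeContent (blocks σ) c) m)    ≡⟨ typedCodes-∑ ps m ⟩
          (∑ L λ (q , ρ) → q ℚ.* typeSeries E⁺ ρ m)                                ≡⟨ ∑-collect _≟ᵀ_ L U! L⊆U (λ ρ → typeSeries E⁺ ρ m) ⟩
          (∑ U λ ρ → total _≟ᵀ_ L ρ ℚ.* typeSeries E⁺ ρ m)
            ≡⟨ ∑-cong U (λ ρ → cong (ℚ._* typeSeries E⁺ ρ m) (total-typedCodes ps ρ)) ⟩
          (∑ U λ ρ → fromℕ (length (codesOf ρ)) ℚ.* typeSeries E⁺ ρ m)             ∎
      }
      where
      ps = All.tabulate code⇒type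
      L = typedCodes (codes (blocks σ)) ps
      U = deduplicate _≟ᵀ_ (map proj₂ L)
      U! : Unique U
      U! = DecUnique.deduplicate-! _≟ᵀ_ (map proj₂ L)
      L⊆U : ∀ {p} → p ∈ L → proj₂ p ∈ U
      L⊆U p∈ = ∈-deduplicate⁺ _≟ᵀ_ (∈-map⁺ proj₂ p∈)

    module _ (τ : Typ n) where

      code : PTdyad-dis σ τ → List (List Brick)
      code (mkDistinct (mkTabloid T _) _) = rowBricks {σ = σ} T

      -- All side conditions of a tabloid are irrelevant fields, so its bricks determine it.
      code-injective : ∀ {t t′} → code t ≡ code t′ → t ≡ t′
      code-injective {mkDistinct (mkTabloid T _) _} {mkDistinct (mkTabloid T′ _) _} eq
        with reduce-bricks-injective T T′ eq
      ... | refl = refl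

      code∈ : ∀ t → code t ∈ codesOf τ
      code∈ (mkDistinct (mkTabloid T content↭) distinct) = ∈-filter⁺ (hasContent? τ)
        (tilings∈codes T (recompute (distinctRows? (rowBricks {σ = σ} T)) distinct))
        (recompute (hasContent? τ (rowBricks {σ = σ} T)) (subst (_↭ blocks τ) (content-code σ T) content↭))

      ∈code : ∀ {c} → c ∈ codesOf τ → ∃[ t ] code t ≡ c
      ∈code c∈ with ∈-filter⁻ (hasContent? τ) {xs = codes (blocks σ)} c∈
      ... | c∈codes , content↭ with codes-tiling (blocks σ) c∈codes
      ...   | T , refl , distinct =
        mkDistinct (mkTabloid T (subst (_↭ blocks τ) (sym (content-code σ T)) content↭)) distinct , refl

      tabloids↔Fin : PTdyad-dis σ τ ↔ Fin (length (codesOf τ))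
      tabloids↔Fin = ↔Fin-length code code-injective (Unique.filter⁺ (hasContent? τ) (codes-unique (blocks σ))) code∈ ∈code

theorem53 : (n : ℕ) (σ τ : Typ n) →
    ∃[ N ] (PTdyad-dis σ τ ↔ Fin N)
    × IsCoefficient (typeSeries E⁺ {n}) τ (typeSeries H σ) (fromℕ N)
theorem53 n σ τ = length (codesOf σ τ) , tabloids↔Fin σ τ , H-expansion σ ,
  λ e → coefficients-unique e (H-expansion σ) τ
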